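{- Let $d$ and $n$ be positive integers. Then \begin{align*} \mathbb{E}[X_{n,dn+1}]&=\frac{d(d+1)(5d+1)(n-1)^2}{24(4d+1)}+\frac{d(d+1)(32d^2+63d+7)(n-1)}{24(4d+1)^2}+\frac{d(d+1)(6d^2+27d+3)}{12(4d+1)^2}\\ &\quad-\frac{M_d(n-1)}{M_d(n)}\Bigl(\frac{d(d+1)(d-1)(n-1)^2}{24(4d+1)}+\frac{d(d+1)(14d^2+21d+1)(n-1)}{24(4d+1)^2}+\frac{d(d+1)(6d^2+27d+3)}{12(4d+1)^2}\Bigr). \end{align*}
   Context: A partition $\lambda=(\lambda_1\ge\dots\ge\lambda_\ell)$ has size $|\lambda|=\sum_i\lambda_i$. The hook length of a box of its Young diagram is the number of boxes directly to its right, directly below it, plus the box itself. For a positive integer $t$, $\lambda$ is a $t$-core if none of its hook lengths is divisible by $t$; an $(s,t)$-core is both an $s$-core and a $t$-core. $X_{n,dn+1}$ is the size of a partition chosen uniformly at random from the finite set of $(n,dn+1)$-core partitions with distinct parts. The sequence $M_d(n)$ is defined by $M_d(-1)=0$, $M_d(0)=1$, $M_d(n)=M_d(n-1)+dM_d(n-2)$ for $n\ge1$ (it is known that $M_d(n)$ equals the number of $(n,dn+1)$-core partitions with distinct parts). -}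

module Defs where

open import Data.Nat as ℕ using (ℕ; zero; suc; _+_; _*_; _∸_; _^_; _<_; _>_; _<ᵇ_)
open import Data.Nat.Divisibility using (_∣_)
open import Data.Integer as ℤ using (ℤ; +_)
open import Data.Rational as ℚ using (ℚ)
open import Data.Nat.ListAction using (sum)
open import Data.List using (List; []; _∷_; length; map; filter; concat; upTo; zip)
open import Data.List.Relation.Unary.All using (All)
open import Data.List.Relation.Unary.Linked using (Linked)
open import Data.List.Relation.Unary.Unique.Propositional using (Unique)
open import Data.List.Membership.Propositional using (_∈_)
open import Data.Bool using (Bool; true; false)
open import Data.Product using (_×_)
open import Relation.Nullary using (¬_)
open import Function.Bundles using (_⇔_)

DistinctPartition : List ℕ → Set
DistinctPartition λs = All (0 <_) λs × Linked _>_ λs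

size : List ℕ → ℕ
size = sum

-- λ'_j : number of parts strictly greater than j (length of column j, 0-indexed)
colLen : List ℕ → ℕ → ℕ
colLen λs j = length (filter (λ p → j ℕ.<? p) λs)

-- hook lengths of the boxes in row i (0-indexed) with row length r:
-- box (i,j), j < r, has hook (r - j) + (λ'_j - i) - 1
rowHooks : List ℕ → ℕ → ℕ → List ℕ
rowHooks λs i r = map (λ j → ((r ∸ j) + (colLen λs j ∸ i)) ∸ 1) (upTo r)

hooksFrom : List ℕ → ℕ → List ℕ → List ℕ
hooksFrom λs i [] = []
hooksFrom λs i (r ∷ rs) = rowHooks λs i r Data.List.++ hooksFrom λs (suc i) rs

hooks : List ℕ → List ℕ
hooks λs = hooksFrom λs 0 λs

IsCore : ℕ → List ℕ → Set
IsCore t λs = All (λ h → ¬ (t ∣ h)) (hooks λs)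

IsCore₂ : ℕ → ℕ → List ℕ → Set
IsCore₂ s t λs = IsCore s λs × IsCore t λs

DistinctCore : ℕ → ℕ → List ℕ → Set
DistinctCore d n λs = DistinctPartition λs × IsCore₂ n (d * n + 1) λs

-- M_d, shifted: M d k = M_d(k) for k ≥ 0 (with M_d(-1) = 0, M_d(0) = 1)
M : ℕ → ℕ → ℕ
M d zero = 1
M d (suc zero) = 1
M d (suc (suc k)) = M d (suc k) + d * M d k

-- total division a / b in ℚ (b = 0 gives 0; only used with b > 0)
frac : ℕ → ℕ → ℚ
frac a zero = ℚ.0ℚ
frac a (suc b) = (+ a) ℚ./ suc b

-- the expectation of the size of a uniformly random element of the
-- finite set enumerated (without repetition) by the list L
expectedSize : List (List ℕ) → ℚ
expectedSize L = frac (sum (map size L)) (length L)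

Enumerates : ℕ → ℕ → List (List ℕ) → Set
Enumerates d n L = Unique L × (∀ λs → (λs ∈ L) ⇔ DistinctCore d n λs)

formula : ℕ → ℕ → ℚ
formula d n =
  (A1 ℚ.+ A2 ℚ.+ A3) ℚ.- (frac (M d m) (M d n) ℚ.* (B1 ℚ.+ B2 ℚ.+ A3))
  where
  m = n ∸ 1
  D = 4 * d + 1
  c = d * (d + 1)
  A1 = frac (c * (5 * d + 1) * (m ^ 2)) (24 * D)
  A2 = frac (c * (32 * d ^ 2 + 63 * d + 7) * m) (24 * D ^ 2)
  A3 = frac (c * (6 * d ^ 2 + 27 * d + 3)) (12 * D ^ 2)
  B1 = frac (c * (d ∸ 1) * (m ^ 2)) (24 * D)
  B2 = frac (c * (14 * d ^ 2 + 21 * d + 1) * m) (24 * D ^ 2)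

{-# OPTIONS --termination-depth=2 #-}
-- The beta-set of a partition (its first-column hook lengths) determines it,
-- and the partition is a t-core with distinct parts iff its beta-set is closed
-- under subtracting multiples of t, avoids 0 and contains no two consecutive
-- numbers.  For t = n and t = dn + 1 this forces the beta-set below dn and off
-- the multiples of n, so it is a flush n-abacus: on runner i (0 < i < n) it occupies the
-- lowest a_i ≤ d positions, and no two neighbouring runners are both occupied.
-- Summing over such (a_1, …, a_m), m = n − 1, the size is
--   Σ i a_i + n Σ a_i (a_i − 1) / 2 − s (s − 1) / 2   with s = Σ a_i.
-- Splitting on whether a_m = 0 gives recurrences in m for the sums of s, s²,
-- Σ i a_i and Σ a_i², which are solved in terms of M d m and M d (m + 1).
module Submission where

open import Defs
open import Data.Empty using (⊥)
import Data.Integer as ℤ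
import Data.Integer.Properties as ℤ
import Data.Integer.Tactic.RingSolver as ℤSolver
open import Data.List hiding (sum)
open import Data.List.Membership.Propositional using (_∈_; _∉_)
open import Data.List.Membership.Propositional.Properties
open import Data.List.Membership.Propositional.Properties.WithK using (unique∧set⇒bag)
open import Data.List.Properties
  using (map-cong-local; filter-accept; filter-reject; filter-all; length-filter; length-downFrom;
         length-map; length-++; map-++; map-∘; map-id-local)
open import Data.List.Relation.Binary.BagAndSetEquality using (∼bag⇒↭)
open import Data.List.Relation.Binary.Permutation.Propositional using (_↭_)
open import Data.List.Relation.Binary.Permutation.Propositional.Properties using (↭-length; map⁺)
open import Data.List.Relation.Unary.All as All using (All; []; _∷_)
import Data.List.Relation.Unary.All.Properties as All
open import Data.List.Relation.Unary.AllPairs as AllPairs using ([]; _∷_)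
open import Data.List.Relation.Unary.Any using (Any; here; there)
open import Data.List.Relation.Unary.Linked as Linked using (Linked; []; [-]; _∷_)
import Data.List.Relation.Unary.Linked.Properties as Linked
open import Data.List.Relation.Unary.Unique.Propositional using (Unique)
import Data.List.Relation.Unary.Unique.Propositional.Properties as Unique
open import Data.Nat
open import Data.Nat.DivMod
open import Data.Nat.Divisibility using (_∣_; divides; ∣⇒≤; n∣m*n)
open import Data.Nat.ListAction using (sum)
open import Data.Nat.ListAction.Properties using (sum-++; sum-↭)
open import Data.Nat.Properties
open import Data.Nat.Tactic.RingSolver using (solve-∀)
open import Data.Product using (∃; ∃₂; _×_; _,_; proj₁; proj₂)
open import Data.Rational as ℚ using (ℚ)
import Data.Rational.Properties as ℚ
open import Data.Rational.Solver using (module +-*-Solver)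
import Data.Rational.Unnormalised as ℚᵘ
import Data.Rational.Unnormalised.Properties as ℚᵘ
open import Data.Sum using (_⊎_; inj₁; inj₂; [_,_]′)
open import Data.Vec as Vec using (Vec; []; _∷_)
import Data.Vec.Properties as Vec
open import Function using (_∘_; case_of_; _⇔_; mk⇔; Equivalence)
open import Relation.Binary.Definitions using (tri<; tri≈; tri>)
open import Relation.Binary.PropositionalEquality
open import Relation.Nullary
open import Relation.Unary using (Decidable)
open import Data.List.Membership.DecPropositional _≟_ using (_∈?_)

-- Beta-sets and hook lengths

-- The two moduli enter asymmetrically. Closure under n makes the runners flush and, since 0 is
-- excluded, empties runner 0. A bead above dn would yield, on subtracting dn and dn + 1, two
-- consecutive beads, which distinct parts forbid. Once all beads lie below dn, closure under dn + 1
-- is vacuous, so it imposes nothing more on the abaci. The characteristic polynomial x² - x - d of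
-- `M` has discriminant 4d + 1. The sums over abaci obey the recurrence of `M` with forcing terms
-- that come from `M` itself, so their solutions are `M d m` and `M d (suc m)` with coefficients
-- polynomial in m, over powers of 4d + 1. Hence the denominators and the quotient of consecutive
-- values of `M` in the result. Two proportionalities shorten the work: the total of Σ i a_i is (m +
-- 1)/2 times the total of s, and the total of Σ a_i² is (2d + 1)/3 times the total of s. Only s²
-- needs a separate quadratic solution. The identities between sums stay in ℕ, with negative terms
-- moved across the equality; they are turned into differences only in ℚ at the end.

beta : List ℕ → List ℕ
beta []       = []
beta (p ∷ ps) = p + length ps ∷ beta ps

parts : List ℕ → List ℕ
parts []       = []
parts (h ∷ hs) = h ∸ length hs ∷ parts hs

length-beta : ∀ ps → length (beta ps) ≡ length ps
length-beta []       = refl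
length-beta (p ∷ ps) = cong suc (length-beta ps)

length-parts : ∀ hs → length (parts hs) ≡ length hs
length-parts []       = refl
length-parts (h ∷ hs) = cong suc (length-parts hs)

parts-beta : ∀ ps → parts (beta ps) ≡ ps
parts-beta []       = refl
parts-beta (p ∷ ps) = cong₂ _∷_
  (trans (cong (p + length ps ∸_) (length-beta ps)) (m+n∸n≡m p (length ps)))
  (parts-beta ps)

-- This makes the truncated subtraction in `parts` exact on strictly decreasing lists, so that
-- `parts` inverts `beta` there.
length≤head : ∀ {h hs} → Linked _>_ (h ∷ hs) → length hs ≤ h
length≤head [-]         = z≤n
length≤head (h>h′ ∷ hs) = ≤-<-trans (length≤head hs) h>h′

beta-parts : ∀ {hs} → Linked _>_ hs → beta (parts hs) ≡ hs
beta-parts {[]}     _  = refl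
beta-parts {h ∷ hs} hs↓ = cong₂ _∷_
  (trans (cong (h ∸ length hs +_) (length-parts hs)) (m∸n+n≡m (length≤head hs↓)))
  (beta-parts (Linked.tail hs↓))

-- Passing to beta-numbers adds 0, 1, ..., l - 1 to the l parts, hence l(l - 1)/2 in total; doubling
-- and moving l² across avoids division and subtraction.
sum-beta : ∀ ps → 2 * sum ps + length ps * length ps ≡ 2 * sum (beta ps) + length ps
sum-beta []       = refl
sum-beta (p ∷ ps) = begin
  2 * (p + sum ps) + suc l * suc l       ≡⟨ shape₁ p (sum ps) l ⟩
  2 * p + 2 * l + 1 + (2 * sum ps + l * l) ≡⟨ cong (2 * p + 2 * l + 1 +_) (sum-beta ps) ⟩
  2 * p + 2 * l + 1 + (2 * b + l)        ≡⟨ shape₂ p b l ⟩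
  2 * (p + l + b) + suc l                ∎
  where
  open ≡-Reasoning
  l = length ps
  b = sum (beta ps)
  shape₁ : ∀ p s l → 2 * (p + s) + suc l * suc l ≡ 2 * p + 2 * l + 1 + (2 * s + l * l)
  shape₁ = solve-∀
  shape₂ : ∀ p b l → 2 * p + 2 * l + 1 + (2 * b + l) ≡ 2 * (p + l + b) + suc l
  shape₂ = solve-∀

-- Consecutive beta-numbers differ by one more than the parts do, so distinct parts mean gaps of at
-- least 2.
Sparse : List ℕ → Set
Sparse hs = All (0 <_) hs × Linked (λ a b → suc b < a) hs

distinct⇒sparse : ∀ {ps} → DistinctPartition ps → Sparse (beta ps)
distinct⇒sparse {[]} _ = [] , []
distinct⇒sparse {p ∷ []} (0<p ∷ [] , _) = <-≤-trans 0<p (m≤m+n p 0) ∷ [] , [-]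
distinct⇒sparse {p ∷ p′ ∷ ps} (0<p ∷ 0<ps , p>p′ ∷ ps↓) =
  let 0<hs , hs↓ = distinct⇒sparse (0<ps , ps↓) in
  <-≤-trans 0<p (m≤m+n p _) ∷ 0<hs ,
  subst (suc (p′ + length ps) <_) (sym (+-suc p (length ps))) (s<s (+-monoˡ-< (length ps) p>p′)) ∷ hs↓

sparse⇒distinct : ∀ {ps} → Sparse (beta ps) → DistinctPartition ps
sparse⇒distinct {[]} _ = [] , []
sparse⇒distinct {p ∷ []} (0<h ∷ [] , _) = subst (0 <_) (+-identityʳ p) 0<h ∷ [] , [-]
sparse⇒distinct {p ∷ p′ ∷ ps} (0<h ∷ 0<hs , gap ∷ hs↓) =
  let 0<ps , ps↓ = sparse⇒distinct (0<hs , hs↓)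
      p>p′ = +-cancelʳ-< (length ps) p′ p (s<s⁻¹ (subst (suc (p′ + length ps) <_) (+-suc p (length ps)) gap))
  in ≤-<-trans z≤n p>p′ ∷ 0<ps , p>p′ ∷ ps↓

-- Flushness of the t-abacus, stated for all multiples of t at once so that it matches divisibility
-- of a hook length directly.
Closed : ℕ → List ℕ → Set
Closed t hs = ∀ {h z} → h ∈ hs → z < h → t ∣ h ∸ z → z ∈ hs

head-bounds : ∀ {p ps} → Linked _>_ (p ∷ ps) → All (_≤ p) ps
head-bounds [-]          = []
head-bounds (p>p′ ∷ ps↓) = <⇒≤ p>p′ ∷ All.map (λ q≤p′ → ≤-trans q≤p′ (<⇒≤ p>p′)) (head-bounds ps↓)

-- For decreasing ps, j ↦ gap ps j enumerates the complement of beta ps.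
gap : List ℕ → ℕ → ℕ
gap []       j = j
gap (p ∷ ps) j with j <? p
... | yes _ = gap ps j
... | no  _ = suc (gap ps j)

-- Each part contributes one to exactly one of the two summands, according to whether it exceeds j.
colLen+gap : ∀ ps j → colLen ps j + gap ps j ≡ length ps + j
colLen+gap []       j = refl
colLen+gap (p ∷ ps) j with j <? p
... | yes j<p = trans (cong (λ c → length c + gap ps j) (filter-accept (j <?_) j<p)) (cong suc (colLen+gap ps j))
... | no  j≮p = trans (cong (λ c → length c + suc (gap ps j)) (filter-reject (j <?_) j≮p))
                      (trans (+-suc _ _) (cong suc (colLen+gap ps j)))

gap-≤ : ∀ ps j → gap ps j ≤ length ps + j
gap-≤ ps j = subst (gap ps j ≤_) (colLen+gap ps j) (m≤n+m (gap ps j) (colLen ps j))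

gap-above : ∀ {ps j} → All (_≤ j) ps → gap ps j ≡ length ps + j
gap-above [] = refl
gap-above {p ∷ ps} {j} (p≤j ∷ ps≤j) with j <? p
... | yes j<p = contradiction p≤j (<⇒≱ j<p)
... | no  _   = cong suc (gap-above ps≤j)

beta-< : ∀ {ps c h} → All (_≤ c) ps → h ∈ beta ps → h < length ps + c
beta-< {p ∷ ps} {c} (p≤c ∷ _)    (here refl) = s≤s (subst (_≤ length ps + c) (+-comm (length ps) p) (+-monoʳ-≤ (length ps) p≤c))
beta-<              (_ ∷ ps≤c) (there h∈)  = m≤n⇒m≤1+n (beta-< ps≤c h∈)

beta-<-head : ∀ {p ps h} → Linked _>_ (p ∷ ps) → h ∈ beta ps → h < p + length ps
beta-<-head {p} {ps} {h} ps↓ h∈ = subst (h <_) (+-comm (length ps) p) (beta-< (head-bounds ps↓) h∈)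

gap∉beta : ∀ {ps} → Linked _>_ ps → ∀ j → gap ps j ∉ beta ps
gap∉beta {p ∷ ps} ps↓ j g∈ with j <? p | g∈
... | yes j<p | here g≡h = <-irrefl (trans g≡h (+-comm p _)) (≤-<-trans (gap-≤ ps j) (+-monoʳ-< (length ps) j<p))
... | yes j<p | there g∈′ = gap∉beta (Linked.tail ps↓) j g∈′
... | no  j≮p | g∈′ = <-irrefl (cong suc (gap-above (All.tail ps≤j))) (beta-< ps≤j g∈′)
  where
  ps≤j : All (_≤ j) (p ∷ ps)
  ps≤j = ≮⇒≥ j≮p ∷ All.map (λ q≤p → ≤-trans q≤p (≮⇒≥ j≮p)) (head-bounds ps↓)

beta⊎gap : ∀ {ps} → Linked _>_ ps → ∀ z → z ∈ beta ps ⊎ ∃ λ j → gap ps j ≡ z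
beta⊎gap {[]}     _   z = inj₂ (z , refl)
beta⊎gap {p ∷ ps} ps↓ z with <-cmp z (p + length ps)
... | tri≈ _ z≡h _ = inj₁ (here z≡h)
... | tri> _ _ h<z = inj₂ (z ∸ suc (length ps) , eq)
  where
  p≤j : p ≤ z ∸ suc (length ps)
  p≤j = subst (_≤ z ∸ suc (length ps)) (m+n∸n≡m p (suc (length ps)))
          (∸-monoˡ-≤ (suc (length ps)) (subst (_≤ z) (sym (+-suc p (length ps))) h<z))
  eq : gap (p ∷ ps) (z ∸ suc (length ps)) ≡ z
  eq = trans (gap-above (p≤j ∷ All.map (λ q≤p → ≤-trans q≤p p≤j) (head-bounds ps↓)))
             (m+[n∸m]≡n (≤-trans (s≤s (m≤n+m _ p)) h<z))
... | tri< z<h _ _ with beta⊎gap (Linked.tail ps↓) z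
...   | inj₁ z∈ = inj₁ (there z∈)
...   | inj₂ (j , gap≡z) = inj₂ (j , eq)
  where
  eq : gap (p ∷ ps) j ≡ z
  eq with j <? p
  ... | yes _   = gap≡z
  -- A column j ≥ p would have its gap at `length ps + j`, which is at least p + length ps and so
  -- not below the largest beta-number.
  ... | no  j≮p = contradiction z<h (≤⇒≯ (≤-trans (≤-reflexive (+-comm p _))
    (≤-trans (+-monoʳ-≤ (length ps) (≮⇒≥ j≮p))
      (≤-reflexive (trans (sym (gap-above (All.map (λ q≤p → ≤-trans q≤p (≮⇒≥ j≮p)) (head-bounds ps↓)))) gap≡z)))))

-- Here p ∸ j counts the arm and the box, and `colLen` over the rows below is the leg. Rows above
-- never matter, so every row can be treated as the first row of what remains, which allows
-- induction on the partition.
firstRowHooks : ℕ → List ℕ → List ℕ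
firstRowHooks p ps = map (λ j → (p ∸ j) + colLen ps j) (upTo p)

hooks′ : List ℕ → List ℕ
hooks′ []       = []
hooks′ (p ∷ ps) = firstRowHooks p ps ++ hooks′ ps

-- The hypothesis says that the i rows above ps are at least as long as those of ps.
hooksFrom≡hooks′ : ∀ {λs i ps} → Linked _>_ ps →
  (∀ j → Any (j <_) ps → colLen λs j ≡ i + colLen ps j) →
  hooksFrom λs i ps ≡ hooks′ ps
hooksFrom≡hooks′ {ps = []} _ _ = refl
hooksFrom≡hooks′ {λs} {i} {p ∷ ps} ps↓ above = cong₂ _++_
  (map-cong-local (All.tabulate λ {j} j∈ → row (∈-upTo⁻ j∈)))
  (hooksFrom≡hooks′ (Linked.tail ps↓) λ j j<ps → below j (any-below (head-bounds ps↓) j<ps) (there j<ps))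
  where
  any-below : ∀ {j ps} → All (_≤ p) ps → Any (j <_) ps → j < p
  any-below (q≤p ∷ _) (here j<q)  = <-≤-trans j<q q≤p
  any-below (_ ∷ qs)  (there j<q) = any-below qs j<q

  below : ∀ j → j < p → Any (j <_) (p ∷ ps) → colLen λs j ≡ suc i + colLen ps j
  below j j<p j<ps = trans (above j j<ps)
    (trans (cong (λ c → i + length c) (filter-accept (j <?_) {xs = ps} j<p)) (+-suc i _))

  row : ∀ {j} → j < p → (p ∸ j) + (colLen λs j ∸ i) ∸ 1 ≡ (p ∸ j) + colLen ps j
  row {j} j<p = begin
    (p ∸ j) + (colLen λs j ∸ i) ∸ 1             ≡⟨ cong (λ c → (p ∸ j) + (c ∸ i) ∸ 1) (below j j<p (here j<p)) ⟩
    (p ∸ j) + (suc (i + colLen ps j) ∸ i) ∸ 1   ≡⟨ cong (λ c → (p ∸ j) + (c ∸ i) ∸ 1) (sym (+-suc i _)) ⟩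
    (p ∸ j) + (i + suc (colLen ps j) ∸ i) ∸ 1   ≡⟨ cong (λ c → (p ∸ j) + c ∸ 1) (m+n∸m≡n i _) ⟩
    (p ∸ j) + suc (colLen ps j) ∸ 1             ≡⟨ cong (_∸ 1) (+-suc (p ∸ j) _) ⟩
    (p ∸ j) + colLen ps j                       ∎
    where open ≡-Reasoning

-- The bridge from hooks to beta-sets: the first-row hook lengths are the differences h - z, where h
-- is the largest beta-number and z < h runs through the numbers absent from the beta-set.
firstRowHook+gap : ∀ {p j} ps → j < p → (p ∸ j) + colLen ps j + gap ps j ≡ p + length ps
firstRowHook+gap {p} {j} ps j<p = begin
  (p ∸ j) + colLen ps j + gap ps j   ≡⟨ +-assoc (p ∸ j) _ _ ⟩
  (p ∸ j) + (colLen ps j + gap ps j) ≡⟨ cong ((p ∸ j) +_) (colLen+gap ps j) ⟩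
  (p ∸ j) + (length ps + j)          ≡⟨ cong ((p ∸ j) +_) (+-comm (length ps) j) ⟩
  (p ∸ j) + (j + length ps)          ≡⟨ +-assoc (p ∸ j) j _ ⟨
  (p ∸ j) + j + length ps            ≡⟨ cong (_+ length ps) (m∸n+n≡m (<⇒≤ j<p)) ⟩
  p + length ps                      ∎
  where open ≡-Reasoning

firstRowHook≡∸gap : ∀ {p j} ps → j < p → (p ∸ j) + colLen ps j ≡ p + length ps ∸ gap ps j
firstRowHook≡∸gap {p} {j} ps j<p =
  trans (sym (m+n∸n≡m _ (gap ps j))) (cong (_∸ gap ps j) (firstRowHook+gap ps j<p))

gap<head : ∀ {p j} ps → j < p → gap ps j < p + length ps
gap<head {p} {j} ps j<p = subst (gap ps j <_) (firstRowHook+gap ps j<p)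
  (m<n+m (gap ps j) (<-≤-trans (m<n⇒0<n∸m j<p) (m≤m+n (p ∸ j) _)))

NoHook : ℕ → ℕ → Set
NoHook t h = ¬ (t ∣ h)

-- A missing z with t dividing h - z would make h - z a forbidden hook length in the row of h. For h
-- not the largest beta-number, the first row is dropped.
core⇒closed′ : ∀ {t ps} → Linked _>_ ps → All (NoHook t) (hooks′ ps) → Closed t (beta ps)
core⇒closed′ {t} {p ∷ ps} ps↓ core {z = z} (here refl) z<h t∣ with beta⊎gap (Linked.tail ps↓) z
... | inj₁ z∈ = there z∈
... | inj₂ (j , refl) = contradiction (subst (t ∣_) (sym (firstRowHook≡∸gap ps j<p)) t∣)
        (All.lookup (All.map⁻ (All.++⁻ˡ (firstRowHooks p ps) core)) (∈-upTo⁺ j<p))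
  where
  j<p : j < p
  j<p = ≰⇒> λ p≤j → <⇒≱ z<h (≤-trans (≤-trans (≤-reflexive (+-comm p _)) (+-monoʳ-≤ (length ps) p≤j))
    (≤-reflexive (sym (gap-above (All.map (λ q≤p → ≤-trans q≤p p≤j) (head-bounds ps↓))))))
core⇒closed′ {t} {p ∷ ps} ps↓ core (there h∈) z<h t∣ =
  there (core⇒closed′ (Linked.tail ps↓) (All.++⁻ʳ (firstRowHooks p ps) core) h∈ z<h t∣)

-- A first-row hook divisible by t would put a gap into the beta-set. Closure passes to the
-- remaining rows because z < h lies below the removed head and so cannot be it.
closed⇒core′ : ∀ {t ps} → Linked _>_ ps → Closed t (beta ps) → All (NoHook t) (hooks′ ps)
closed⇒core′ {ps = []} _ _ = []
closed⇒core′ {t} {p ∷ ps} ps↓ closed = All.++⁺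
  (All.map⁺ (All.tabulate λ {j} j∈ t∣ →
    let j<p = ∈-upTo⁻ j∈ ; g<h = gap<head ps j<p in
    gap∉beta (Linked.tail ps↓) j
      (not-head g<h (closed (here refl) g<h (subst (t ∣_) (firstRowHook≡∸gap ps j<p) t∣)))))
  (closed⇒core′ (Linked.tail ps↓) λ h∈ z<h t∣ →
    not-head (<-trans z<h (beta-<-head ps↓ h∈)) (closed (there h∈) z<h t∣))
  where
  not-head : ∀ {z} → z < p + length ps → z ∈ beta (p ∷ ps) → z ∈ beta ps
  not-head z<h (here z≡h)  = contradiction z≡h (<⇒≢ z<h)
  not-head z<h (there z∈)  = z∈

core⇒closed : ∀ {t ps} → Linked _>_ ps → IsCore t ps → Closed t (beta ps)
core⇒closed {t} ps↓ core =
  core⇒closed′ ps↓ (subst (All (NoHook t)) (hooksFrom≡hooks′ ps↓ λ _ _ → refl) core)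

closed⇒core : ∀ {t ps} → Linked _>_ ps → Closed t (beta ps) → IsCore t ps
closed⇒core {t} ps↓ closed =
  subst (All (NoHook t)) (sym (hooksFrom≡hooks′ ps↓ λ _ _ → refl)) (closed⇒core′ ps↓ closed)

-- Beta-sets of cores as abaci

-- Position i + q * n of the n-abacus is row q of runner i.  An abacus with
-- flush runners 1, …, m is the vector (a_m, …, a_1) of their bead counts.
runner : ∀ {m} → Vec ℕ m → ℕ → ℕ
runner []              i = 0
runner {suc m} (x ∷ a) i with i ≟ suc m
... | yes _ = x
... | no  _ = runner a i

runner-here : ∀ {m} x (a : Vec ℕ m) → runner (x ∷ a) (suc m) ≡ x
runner-here {m} x a with suc m ≟ suc m
... | yes _ = refl
... | no  ≢ = contradiction refl ≢

runner-there : ∀ {m i} x (a : Vec ℕ m) → i ≢ suc m → runner (x ∷ a) i ≡ runner a i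
runner-there {m} {i} x a i≢ with i ≟ suc m
... | yes i≡ = contradiction i≡ i≢
... | no  _  = refl

runner-support : ∀ {m i} (a : Vec ℕ m) → 0 < runner a i → 0 < i × i ≤ m
runner-support {suc m} {i} (x ∷ a) 0<r with i ≟ suc m
... | yes refl = z<s , ≤-refl
... | no  _    = let 0<i , i≤m = runner-support a 0<r in 0<i , m≤n⇒m≤1+n i≤m

runner-outside : ∀ {m i} (a : Vec ℕ m) → m < i → runner a i ≡ 0
runner-outside {i = i} a m<i with runner a i in eq
... | zero  = refl
... | suc _ = contradiction (proj₂ (runner-support a (subst (0 <_) (sym eq) z<s))) (<⇒≱ m<i)

runner-ext : ∀ {m} (a b : Vec ℕ m) → (∀ i → 0 < i → i ≤ m → runner a i ≡ runner b i) → a ≡ b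
runner-ext [] [] _ = refl
runner-ext {suc m} (x ∷ a) (y ∷ b) eq = cong₂ _∷_
  (trans (sym (runner-here x a)) (trans (eq (suc m) z<s ≤-refl) (runner-here y b)))
  (runner-ext a b λ i 0<i i≤m → let i≢ = <⇒≢ (s≤s i≤m) in
    trans (sym (runner-there x a i≢)) (trans (eq i 0<i (m≤n⇒m≤1+n i≤m)) (runner-there y b i≢)))

Bounded : ∀ {m} → ℕ → Vec ℕ m → Set
Bounded d a = ∀ i → runner a i ≤ d

-- All i are allowed because `runner` is 0 outside 1, ..., m, which settles both ends without side
-- conditions.
NoNeighbours : ∀ {m} → Vec ℕ m → Set
NoNeighbours a = ∀ i → runner a i ≡ 0 ⊎ runner a (suc i) ≡ 0

Valid : ∀ {m} → ℕ → Vec ℕ m → Set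
Valid d a = Bounded d a × NoNeighbours a

valid-[] : ∀ {d} → Valid d []
valid-[] = (λ _ → z≤n) , (λ _ → inj₁ refl)

valid-∷ : ∀ {d m x} {a : Vec ℕ m} → x ≤ d → x ≡ 0 ⊎ runner a m ≡ 0 → Valid d a → Valid d (x ∷ a)
valid-∷ {d} {m} {x} {a} x≤d x⊎a (a≤d , alone) = bounded , alone′
  where
  bounded : Bounded d (x ∷ a)
  bounded i with i ≟ suc m
  ... | yes _ = x≤d
  ... | no  _ = a≤d i
  alone′ : NoNeighbours (x ∷ a)
  alone′ i with i ≟ suc m | suc i ≟ suc m
  ... | yes refl | yes ()
  ... | yes refl | no  _    = inj₂ (runner-outside a (m<n⇒m<1+n (n<1+n m)))
  ... | no  _    | no  _    = alone i
  ... | no  _    | yes refl = [ inj₂ , inj₁ ]′ x⊎a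

valid-uncons : ∀ {d m x} {a : Vec ℕ m} → Valid d (x ∷ a) → x ≤ d × (x ≡ 0 ⊎ runner a m ≡ 0) × Valid d a
valid-uncons {d} {m} {x} {a} (xa≤d , alone) =
  subst (_≤ d) (runner-here x a) (xa≤d (suc m)) ,
  [ inj₂ ∘ trans (sym (runner-there x a (<⇒≢ (n<1+n m)))) , inj₁ ∘ trans (sym (runner-here x a)) ]′ (alone m) ,
  bounded , alone′
  where
  bounded : Bounded d a
  bounded i with i ≟ suc m
  ... | yes refl = subst (_≤ d) (sym (runner-outside a (n<1+n m))) z≤n
  ... | no  i≢   = subst (_≤ d) (runner-there x a i≢) (xa≤d i)
  alone′ : NoNeighbours a
  alone′ i with i ≤? m | suc i ≤? m
  ... | no  i≰m | _         = inj₁ (runner-outside a (≰⇒> i≰m))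
  ... | yes _   | no  1+i≰m = inj₂ (runner-outside a (≰⇒> 1+i≰m))
  ... | yes i≤m | yes 1+i≤m with alone i
  ...   | inj₁ r≡0 = inj₁ (trans (sym (runner-there x a (<⇒≢ (s≤s i≤m)))) r≡0)
  ...   | inj₂ r≡0 = inj₂ (trans (sym (runner-there x a (<⇒≢ (s≤s 1+i≤m)))) r≡0)

-- Built by the two-step recursion of `M`: either the last runner is empty, or it holds k + 1 beads
-- and the one before it is empty. A single runner has no predecessor to be emptied and forms its
-- own base case.
abaci : ℕ → ∀ m → List (Vec ℕ m)
abaci d zero          = [] ∷ []
abaci d (suc zero)    = map (_∷ []) (downFrom (suc d))
abaci d (suc (suc m)) = map (0 ∷_) (abaci d (suc m)) ++
                        cartesianProductWith (λ k a → suc k ∷ 0 ∷ a) (downFrom d) (abaci d m)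

∈-abaci⁻ : ∀ d m {a} → a ∈ abaci d m → Valid d a
∈-abaci⁻ d zero (here refl) = valid-[]
∈-abaci⁻ d (suc zero) a∈ with ∈-map⁻ (_∷ []) a∈
... | x , x∈ , refl = valid-∷ (s≤s⁻¹ (∈-downFrom⁻ x∈)) (inj₂ refl) valid-[]
∈-abaci⁻ d (suc (suc m)) a∈ with ∈-++⁻ (map (0 ∷_) (abaci d (suc m))) a∈
... | inj₁ a∈ˡ with ∈-map⁻ (0 ∷_) a∈ˡ
...   | b , b∈ , refl = valid-∷ z≤n (inj₁ refl) (∈-abaci⁻ d (suc m) b∈)
∈-abaci⁻ d (suc (suc m)) a∈ | inj₂ a∈ʳ with ∈-cartesianProductWith⁻ _ (downFrom d) (abaci d m) a∈ʳ
...   | k , b , k∈ , b∈ , refl = valid-∷ (∈-downFrom⁻ k∈) (inj₂ (runner-here 0 b))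
                                   (valid-∷ z≤n (inj₁ refl) (∈-abaci⁻ d m b∈))

∈-abaci⁺ : ∀ d m {a} → Valid d a → a ∈ abaci d m
∈-abaci⁺ d zero       {[]}     _ = here refl
∈-abaci⁺ d (suc zero) {x ∷ []} v = ∈-map⁺ (_∷ []) (∈-downFrom⁺ (s≤s (proj₁ (valid-uncons v))))
∈-abaci⁺ d (suc (suc m)) {zero ∷ a} v =
  ∈-++⁺ˡ (∈-map⁺ (0 ∷_) (∈-abaci⁺ d (suc m) (proj₂ (proj₂ (valid-uncons v)))))
∈-abaci⁺ d (suc (suc m)) {suc k ∷ y ∷ a} v with valid-uncons v
... | k<d , inj₂ r≡0 , v′ with trans (sym (runner-here y a)) r≡0
...   | refl = ∈-++⁺ʳ (map (0 ∷_) (abaci d (suc m))) (∈-cartesianProductWith⁺ (λ k a → suc k ∷ 0 ∷ a)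
                 (∈-downFrom⁺ k<d) (∈-abaci⁺ d m (proj₂ (proj₂ (valid-uncons v′)))))

abaci-unique : ∀ d m → Unique (abaci d m)
abaci-unique d zero          = [] ∷ []
abaci-unique d (suc zero)    = Unique.map⁺ Vec.∷-injectiveˡ (Unique.downFrom⁺ (suc d))
abaci-unique d (suc (suc m)) = Unique.++⁺
  (Unique.map⁺ Vec.∷-injectiveʳ (abaci-unique d (suc m)))
  (Unique.cartesianProductWith⁺ _
    (λ eq → suc-injective (Vec.∷-injectiveˡ eq) , Vec.∷-injectiveʳ (Vec.∷-injectiveʳ eq))
    (Unique.downFrom⁺ d) (abaci-unique d m))
  disjoint
  where
  disjoint : ∀ {a} → a ∈ map (0 ∷_) (abaci d (suc m)) ×
                     a ∈ cartesianProductWith (λ k a → suc k ∷ 0 ∷ a) (downFrom d) (abaci d m) → ⊥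
  disjoint (a∈ˡ , a∈ʳ) with ∈-map⁻ (0 ∷_) a∈ˡ | ∈-cartesianProductWith⁻ _ (downFrom d) (abaci d m) a∈ʳ
  ... | _ , _ , refl | _ , _ , _ , _ , ()

beads : ∀ {m} → ℕ → Vec ℕ m → List ℕ
beads         n []      = []
beads {suc m} n (x ∷ a) = map (λ q → suc m + q * n) (downFrom x) ++ beads n a

∈-beads⁺ : ∀ {m} n (a : Vec ℕ m) {i q} → q < runner a i → i + q * n ∈ beads n a
∈-beads⁺ {suc m} n (x ∷ a) {i} q<r with i ≟ suc m
... | yes refl = ∈-++⁺ˡ (∈-map⁺ (λ q → suc m + q * n) (∈-downFrom⁺ q<r))
... | no  _    = ∈-++⁺ʳ (map (λ q → suc m + q * n) (downFrom x)) (∈-beads⁺ n a q<r)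

∈-beads⁻ : ∀ {m} n (a : Vec ℕ m) {z} → z ∈ beads n a → ∃₂ λ i q → z ≡ i + q * n × q < runner a i
∈-beads⁻ {suc m} n (x ∷ a) z∈ with ∈-++⁻ (map (λ q → suc m + q * n) (downFrom x)) z∈
... | inj₁ z∈ˡ with ∈-map⁻ (λ q → suc m + q * n) z∈ˡ
...   | q , q∈ , refl = suc m , q , refl , subst (q <_) (sym (runner-here x a)) (∈-downFrom⁻ q∈)
∈-beads⁻ {suc m} n (x ∷ a) z∈ | inj₂ z∈ʳ with ∈-beads⁻ n a z∈ʳ
... | i , q , refl , q<r = i , q , refl , subst (q <_) (sym (runner-there x a i≢)) q<r
  where
  i≢ : i ≢ suc m
  i≢ i≡ = <⇒≱ (s≤s (proj₂ (runner-support a (≤-<-trans z≤n q<r)))) (≤-reflexive (sym i≡))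

divMod-unique : ∀ {n i i′} q q′ → i < n → i′ < n → i + q * n ≡ i′ + q′ * n → i ≡ i′ × q ≡ q′
divMod-unique {n@(suc _)} {i} {i′} q q′ i<n i′<n eq = i≡i′ ,
  *-cancelʳ-≡ q q′ n (+-cancelˡ-≡ i′ _ _ (subst (λ j → j + q * n ≡ i′ + q′ * n) i≡i′ eq))
  where
  open ≡-Reasoning
  i≡i′ : i ≡ i′
  i≡i′ = begin
    i                 ≡⟨ m<n⇒m%n≡m i<n ⟨
    i % n             ≡⟨ [m+kn]%n≡m%n i q n ⟨
    (i + q * n) % n   ≡⟨ cong (_% n) eq ⟩
    (i′ + q′ * n) % n ≡⟨ [m+kn]%n≡m%n i′ q′ n ⟩
    i′ % n            ≡⟨ m<n⇒m%n≡m i′<n ⟩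
    i′                ∎

-- Since m < n, a position determines its runner and row, so membership can be read off at the given
-- i and q.
∈-beads⇒<runner : ∀ {m n i} q (a : Vec ℕ m) → m < n → i < n → i + q * n ∈ beads n a → q < runner a i
∈-beads⇒<runner {n = n} q a m<n i<n z∈ with ∈-beads⁻ n a z∈
... | i′ , q′ , eq , q′<r
    with divMod-unique q q′ i<n (≤-<-trans (proj₂ (runner-support a (≤-<-trans z≤n q′<r))) m<n) eq
...   | refl , refl = q′<r

beads-unique : ∀ {m} n (a : Vec ℕ m) → m < n → Unique (beads n a)
beads-unique n [] _ = []
beads-unique {suc m} n@(suc _) (x ∷ a) m<n = Unique.++⁺
  (Unique.map⁺ (λ {q} {q′} eq → *-cancelʳ-≡ q q′ n (+-cancelˡ-≡ (suc m) _ _ eq)) (Unique.downFrom⁺ x))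
  (beads-unique n a (<-trans (n<1+n m) m<n))
  λ (z∈ˡ , z∈ʳ) → disjoint z∈ˡ z∈ʳ
  where
  disjoint : ∀ {z} → z ∈ map (λ q → suc m + q * n) (downFrom x) → z ∉ beads n a
  disjoint z∈ˡ z∈ʳ with ∈-map⁻ (λ q → suc m + q * n) z∈ˡ
  ... | q , _ , refl = contradiction
    (subst (q <_) (runner-outside a (n<1+n m)) (∈-beads⇒<runner q a (<-trans (n<1+n m) m<n) m<n z∈ʳ)) n≮0

bead-< : ∀ {m} d n (a : Vec ℕ m) → m < n → Bounded d a → ∀ {z} → z ∈ beads n a → z < d * n
bead-< d n a m<n a≤d z∈ with ∈-beads⁻ n a z∈
... | i , q , refl , q<r = <-≤-trans
  (+-monoˡ-< (q * n) (≤-<-trans (proj₂ (runner-support a (≤-<-trans z≤n q<r))) m<n))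
  (*-monoˡ-≤ n (≤-trans q<r (a≤d i)))

-- `beads` goes runner by runner and is not sorted; filtering a descending range gives the
-- decreasing order that `parts` requires. Below d * n nothing is lost when every runner holds at
-- most d beads.
betaSet : ∀ {m} → ℕ → ℕ → Vec ℕ m → List ℕ
betaSet d n a = filter (_∈? beads n a) (downFrom (d * n))

∈-betaSet⁻ : ∀ {m} d n (a : Vec ℕ m) {z} → z ∈ betaSet d n a → z ∈ beads n a
∈-betaSet⁻ d n a z∈ = proj₂ (∈-filter⁻ (_∈? beads n a) {xs = downFrom (d * n)} z∈)

∈-betaSet⁺ : ∀ {m} d n (a : Vec ℕ m) → m < n → Bounded d a → ∀ {z} → z ∈ beads n a → z ∈ betaSet d n a
∈-betaSet⁺ d n a m<n a≤d z∈ = ∈-filter⁺ (_∈? beads n a) (∈-downFrom⁺ (bead-< d n a m<n a≤d z∈)) z∈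

downFrom-↓ : ∀ n → Linked _>_ (downFrom n)
downFrom-↓ n = Linked.applyDownFrom⁺₁ (λ i → i) n λ _ → ≤-refl

betaSet-↓ : ∀ {m} d n (a : Vec ℕ m) → Linked _>_ (betaSet d n a)
betaSet-↓ d n a = Linked.filter⁺ (_∈? beads n a) (λ i>j j>k → <-trans j>k i>j) (downFrom-↓ (d * n))

↓⇒unique : ∀ {hs} → Linked _>_ hs → Unique hs
↓⇒unique hs↓ = AllPairs.map (λ i>j i≡j → <⇒≢ i>j (sym i≡j)) (Linked.Linked⇒AllPairs (λ i>j j>k → <-trans j>k i>j) hs↓)

unique∧⇔⇒↭ : ∀ {A : Set} {xs ys : List A} → Unique xs → Unique ys → (∀ z → z ∈ xs ⇔ z ∈ ys) → xs ↭ ys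
unique∧⇔⇒↭ xs! ys! xs⇔ys = ∼bag⇒↭ (unique∧set⇒bag xs! ys! (xs⇔ys _))

betaSet↭beads : ∀ {m} d n (a : Vec ℕ m) → m < n → Bounded d a → betaSet d n a ↭ beads n a
betaSet↭beads d n a m<n a≤d = unique∧⇔⇒↭ (↓⇒unique (betaSet-↓ d n a)) (beads-unique n a m<n)
  λ z → mk⇔ (∈-betaSet⁻ d n a) (∈-betaSet⁺ d n a m<n a≤d)

-- Subtracting k * n keeps the runner and lowers the row by k, and a flush runner contains all its
-- lower rows.
betaSet-closed-n : ∀ {m} d n (a : Vec ℕ m) → m < n → Bounded d a → Closed n (betaSet d n a)
betaSet-closed-n d n@(suc _) a m<n a≤d {h} {z} h∈ z<h (divides k h∸z≡kn)
  with ∈-beads⁻ n a (∈-betaSet⁻ d n a h∈)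
... | i , q , refl , q<r = ∈-betaSet⁺ d n a m<n a≤d (subst (_∈ beads n a) (sym (m≡m%n+[m/n]*n z n))
    (∈-beads⁺ n a (subst (λ j → z / n < runner a j) z%n≡i
      (≤-<-trans (subst (z / n ≤_) z/n+k≡q (m≤m+n (z / n) k)) q<r))))
  where
  open ≡-Reasoning
  eq : z % n + (z / n + k) * n ≡ i + q * n
  eq = begin
    z % n + (z / n + k) * n         ≡⟨ cong (z % n +_) (*-distribʳ-+ n (z / n) k) ⟩
    z % n + (z / n * n + k * n)     ≡⟨ +-assoc (z % n) _ _ ⟨
    z % n + z / n * n + k * n       ≡⟨ cong₂ _+_ (m≡m%n+[m/n]*n z n) h∸z≡kn ⟨
    z + (h ∸ z)                     ≡⟨ m+[n∸m]≡n (<⇒≤ z<h) ⟩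
    h                               ∎
  unique = divMod-unique (z / n + k) q (m%n<n z n)
    (≤-<-trans (proj₂ (runner-support a (≤-<-trans z≤n q<r))) m<n) eq
  z/n+k≡q = proj₂ unique
  z%n≡i : i ≡ z % n
  z%n≡i = sym (proj₁ unique)

-- Vacuous: a positive multiple of dn + 1 is too large to be subtracted from a number below dn.
betaSet-closed-dn+1 : ∀ {m} d n (a : Vec ℕ m) → Closed (d * n + 1) (betaSet d n a)
betaSet-closed-dn+1 d n a {h} {z} h∈ z<h dn+1∣ = contradiction h<dn (≤⇒≯ (begin
  d * n     ≤⟨ m≤m+n (d * n) 1 ⟩
  d * n + 1 ≤⟨ ∣⇒≤ {{>-nonZero (m<n⇒0<n∸m z<h)}} dn+1∣ ⟩
  h ∸ z     ≤⟨ m∸n≤m h z ⟩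
  h         ∎))
  where
  open ≤-Reasoning
  h<dn : h < d * n
  h<dn = ∈-downFrom⁻ (proj₁ (∈-filter⁻ (_∈? beads n a) {xs = downFrom (d * n)} h∈))

NonConsecutive : List ℕ → Set
NonConsecutive hs = ∀ {h} → h ∈ hs → suc h ∉ hs

nonConsecutive⇒sparse : ∀ {hs} → 0 ∉ hs → NonConsecutive hs → Linked _>_ hs → Sparse hs
nonConsecutive⇒sparse 0∉ apart hs↓ = All.tabulate (λ h∈ → n≢0⇒n>0 λ h≡0 → 0∉ (subst (_∈ _) h≡0 h∈)) , go apart hs↓
  where
  go : ∀ {hs} → NonConsecutive hs → Linked _>_ hs → Linked (λ a b → suc b < a) hs
  go _     []           = []
  go _     [-]          = [-]
  go apart (a>b ∷ hs↓) = ≤∧≢⇒< a>b (λ 1+b≡a → apart (there (here refl)) (here 1+b≡a)) ∷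
    go (λ h∈ 1+h∈ → apart (there h∈) (there 1+h∈)) hs↓

sparse⇒nonConsecutive : ∀ {hs} → Sparse hs → NonConsecutive hs
sparse⇒nonConsecutive (_ , hs↓) =
  go (Linked.Linked⇒AllPairs (λ 1+b<a 1+c<b → <-trans 1+c<b (<-trans (n<1+n _) 1+b<a)) hs↓)
  where
  go : ∀ {hs} → AllPairs.AllPairs (λ a b → suc b < a) hs → NonConsecutive hs
  go (_ ∷ _)    (here refl) (here ())
  go (gaps ∷ _) (here refl) (there 1+h∈) = <-asym (All.lookup gaps 1+h∈) (m<n⇒m<1+n (n<1+n _))
  go (gaps ∷ _) (there h∈)  (here refl)  = <-irrefl refl (All.lookup gaps h∈)
  go (_ ∷ hs)   (there h∈)  (there 1+h∈) = go hs h∈ 1+h∈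

-- Consecutive beads would sit in one row on neighbouring runners. Wrapping from runner n - 1 to the
-- next row cannot occur, since runner 0 is empty.
betaSet-sparse : ∀ {m} d n (a : Vec ℕ m) → m < n → Valid d a → Sparse (betaSet d n a)
betaSet-sparse d n a m<n (a≤d , alone) = nonConsecutive⇒sparse
  (λ 0∈ → zero-free (∈-betaSet⁻ d n a 0∈))
  (λ h∈ 1+h∈ → apart (∈-betaSet⁻ d n a h∈) (∈-betaSet⁻ d n a 1+h∈))
  (betaSet-↓ d n a)
  where
  zero-free : 0 ∉ beads n a
  zero-free 0∈ with ∈-beads⁻ n a 0∈
  ... | zero , _ , _ , q<r = n≮0 (proj₁ (runner-support a (≤-<-trans z≤n q<r)))
  apart : NonConsecutive (beads n a)
  apart {h} h∈ 1+h∈ with ∈-beads⁻ n a 1+h∈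
  ... | zero , _ , _ , q<r = n≮0 (proj₁ (runner-support a (≤-<-trans z≤n q<r)))
  ... | suc i , q , refl , q<r = [ (λ r≡0 → n≮0 (subst (q <_) r≡0 q<r′)) , (λ r≡0 → n≮0 (subst (q <_) r≡0 q<r)) ]′ (alone i)
    where
    q<r′ : q < runner a i
    q<r′ = ∈-beads⇒<runner q a m<n
      (<-trans (n<1+n i) (≤-<-trans (proj₂ (runner-support a (≤-<-trans z≤n q<r))) m<n)) h∈

-- Recovering the abacus of a core by counting beads

module _ {P : ℕ → Set} (P? : Decidable P) where

  count : ℕ → ℕ
  count d = length (filter P? (downFrom d))

  count-≤ : ∀ d → count d ≤ d
  count-≤ d = ≤-trans (length-filter P? (downFrom d)) (≤-reflexive (length-downFrom d))

  -- A downward closed set of rows is an initial segment, so its cardinality below d is also its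
  -- threshold; this turns membership in a beta-set into a comparison with a bead count.
  count-spec : (∀ {q q′} → P q → q′ < q → P q′) → ∀ d q → q < d → P q ⇔ q < count d
  count-spec down (suc d) q q<1+d with P? d
  ... | yes Pd = mk⇔
        (λ _ → subst (q <_) (sym count≡1+d) q<1+d)
        (λ _ → [ down Pd , (λ q≡d → subst P (sym q≡d) Pd) ]′ (m≤n⇒m<n∨m≡n (s≤s⁻¹ q<1+d)))
    where
    count≡1+d : suc (count d) ≡ suc d
    count≡1+d = cong suc (trans
      (cong length (filter-all P? (All.tabulate λ q∈ → down Pd (∈-downFrom⁻ q∈)))) (length-downFrom d))
  ... | no ¬Pd with m≤n⇒m<n∨m≡n (s≤s⁻¹ q<1+d)
  ...   | inj₁ q<d  = count-spec down d q q<d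
  ...   | inj₂ refl = mk⇔ (λ Pd → contradiction Pd ¬Pd) (λ d<c → contradiction (count-≤ d) (<⇒≱ d<c))

  initial-segment-down : ∀ {c} → (∀ q → P q ⇔ q < c) → ∀ {q q′} → P q → q′ < q → P q′
  initial-segment-down spec Pq q′<q = Equivalence.from (spec _) (<-trans q′<q (Equivalence.to (spec _) Pq))

  count-unique : ∀ {c} d → c ≤ d → (∀ q → P q ⇔ q < c) → count d ≡ c
  count-unique {c} d c≤d spec with <-cmp (count d) c
  ... | tri≈ _ eq _ = eq
  ... | tri< n<c _ _ = contradiction
    (Equivalence.to (count-spec (initial-segment-down spec) d _ (<-≤-trans n<c c≤d)) (Equivalence.from (spec _) n<c)) (<-irrefl refl)
  ... | tri> _ _ c<n = contradiction
    (Equivalence.to (spec _) (Equivalence.from (count-spec (initial-segment-down spec) d c (<-≤-trans c<n (count-≤ d))) c<n)) (<-irrefl refl)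

beadCount : ℕ → ℕ → List ℕ → ℕ → ℕ
beadCount d n hs i = count (λ q → i + q * n ∈? hs) d

abacus : ℕ → ℕ → List ℕ → ∀ m → Vec ℕ m
abacus d n hs zero    = []
abacus d n hs (suc m) = beadCount d n hs (suc m) ∷ abacus d n hs m

runner-abacus : ∀ d n hs {m i} → 0 < i → i ≤ m → runner (abacus d n hs m) i ≡ beadCount d n hs i
runner-abacus d n hs {zero}  0<i i≤0 = contradiction i≤0 (<⇒≱ 0<i)
runner-abacus d n hs {suc m} {i} 0<i i≤1+m with i ≟ suc m
... | yes refl = refl
... | no  i≢   = runner-abacus d n hs 0<i (s≤s⁻¹ (≤∧≢⇒< i≤1+m i≢))

abacus-betaSet : ∀ {m} d n (a : Vec ℕ m) → m < n → Bounded d a → abacus d n (betaSet d n a) m ≡ a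
abacus-betaSet {m} d n a m<n a≤d = runner-ext _ a λ i 0<i i≤m →
  trans (runner-abacus d n (betaSet d n a) 0<i i≤m)
    (count-unique (λ q → i + q * n ∈? betaSet d n a) d (a≤d i) λ q → mk⇔
      (λ z∈ → ∈-beads⇒<runner q a m<n (≤-<-trans i≤m m<n) (∈-betaSet⁻ d n a z∈))
      (λ q<r → ∈-betaSet⁺ d n a m<n a≤d (∈-beads⁺ n a q<r)))

↓-ext : ∀ {xs ys} → Linked _>_ xs → Linked _>_ ys → (∀ z → z ∈ xs ⇔ z ∈ ys) → xs ≡ ys
↓-ext {[]}     {[]}     _   _   _  = refl
↓-ext {[]}     {y ∷ ys} _   _   eq = case Equivalence.from (eq y) (here refl) of λ ()
↓-ext {x ∷ xs} {[]}     _   _   eq = case Equivalence.to (eq x) (here refl) of λ ()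
↓-ext {x ∷ xs} {y ∷ ys} xs↓ ys↓ eq = cong₂ _∷_ x≡y (↓-ext (Linked.tail xs↓) (Linked.tail ys↓) λ z → mk⇔
    (λ z∈ → below x≡y xs↓ z∈ (Equivalence.to (eq z) (there z∈)))
    (λ z∈ → below (sym x≡y) ys↓ z∈ (Equivalence.from (eq z) (there z∈))))
  where
  tail-< : ∀ {w z ws} → Linked _>_ (w ∷ ws) → z ∈ ws → z < w
  tail-< ws↓ z∈ = All.lookup (AllPairs.head (Linked.Linked⇒AllPairs (λ i>j j>k → <-trans j>k i>j) ws↓)) z∈
  ≤head : ∀ {w z ws} → Linked _>_ (w ∷ ws) → z ∈ w ∷ ws → z ≤ w
  ≤head ws↓ (here refl) = ≤-refl
  ≤head ws↓ (there z∈)  = <⇒≤ (tail-< ws↓ z∈)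
  x≡y : x ≡ y
  x≡y = ≤-antisym (≤head ys↓ (Equivalence.to (eq x) (here refl))) (≤head xs↓ (Equivalence.from (eq y) (here refl)))
  below : ∀ {v w vs ws z} → v ≡ w → Linked _>_ (v ∷ vs) → z ∈ vs → z ∈ w ∷ ws → z ∈ ws
  below v≡w vs↓ z∈ (here z≡w) = contradiction (trans z≡w (sym v≡w)) (<⇒≢ (tail-< vs↓ z∈))
  below v≡w vs↓ z∈ (there z∈ws) = z∈ws

CoreSet : ℕ → ℕ → List ℕ → Set
CoreSet d n hs = Sparse hs × Closed n hs × Closed (d * n + 1) hs

betaSet-coreSet : ∀ {m} d n (a : Vec ℕ m) → m < n → Valid d a → CoreSet d n (betaSet d n a)
betaSet-coreSet d n a m<n v =
  betaSet-sparse d n a m<n v , betaSet-closed-n d n a m<n (proj₁ v) , betaSet-closed-dn+1 d n a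

sparse⇒↓ : ∀ {hs} → Sparse hs → Linked _>_ hs
sparse⇒↓ (_ , hs↓) = Linked.map (<-trans (n<1+n _)) hs↓

module _ (d m : ℕ) {hs : List ℕ} (0<d : 0 < d) (core : CoreSet d (suc m) hs) where

  private
    n = suc m
    sparse   = proj₁ core
    closed   = proj₁ (proj₂ core)
    closed′  = proj₂ (proj₂ core)
    a        = abacus d n hs m

  0∉coreSet : 0 ∉ hs
  0∉coreSet 0∈ = <-irrefl refl (All.lookup (proj₁ sparse) 0∈)

  -- A bead on runner 0 would be pushed down to 0.
  coreSet-∤ : ∀ q → q * n ∉ hs
  coreSet-∤ zero    0∈  = 0∉coreSet 0∈
  coreSet-∤ (suc q) h∈ = 0∉coreSet (closed h∈ z<s (n∣m*n (suc q)))

  -- For h > dn, closure under dn + 1 gives h - (dn + 1) and closure under n gives h - dn; these are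
  -- consecutive. Positivity of d makes the second subtraction proper.
  coreSet-< : ∀ {h} → h ∈ hs → h < d * n
  coreSet-< {h} h∈ with <-cmp h (d * n)
  ... | tri< h<dn _ _ = h<dn
  ... | tri≈ _ refl _ = contradiction h∈ (coreSet-∤ d)
  ... | tri> _ _ dn<h = contradiction 1+z∈ (sparse⇒nonConsecutive sparse z∈)
    where
    dn+1≤h : d * n + 1 ≤ h
    dn+1≤h = subst (_≤ h) (+-comm 1 (d * n)) dn<h
    z∈ : h ∸ (d * n + 1) ∈ hs
    z∈ = closed′ h∈ (∸-monoʳ-< {h} (m≤n+m 1 (d * n)) dn+1≤h)
      (divides 1 (trans (m∸[m∸n]≡n dn+1≤h) (sym (*-identityˡ _))))
    1+z∈ : suc (h ∸ (d * n + 1)) ∈ hs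
    1+z∈ = subst (_∈ hs) (trans (+-∸-assoc 1 dn<h) (cong (λ c → suc (h ∸ c)) (+-comm 1 (d * n))))
      (closed h∈ (∸-monoʳ-< {h} (*-mono-≤ 0<d (s≤s (z≤n {m}))) (<⇒≤ dn<h))
        (divides d (m∸[m∸n]≡n (<⇒≤ dn<h))))

  column-down : ∀ {i q q′} → i + q * n ∈ hs → q′ < q → i + q′ * n ∈ hs
  column-down {i} {q} {q′} h∈ q′<q = closed h∈ (+-monoʳ-< i (*-monoˡ-< n q′<q))
    (divides (q ∸ q′) (trans ([m+n]∸[m+o]≡n∸o i (q * n) (q′ * n)) (sym (*-distribʳ-∸ n q q′))))

  <runner⇔∈ : ∀ {i q} → 0 < i → i ≤ m → q < d → (i + q * n ∈ hs ⇔ q < runner a i)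
  <runner⇔∈ {i} {q} 0<i i≤m q<d = subst (λ c → (i + q * n ∈ hs) ⇔ (q < c)) (sym (runner-abacus d n hs 0<i i≤m))
    (count-spec (λ q → i + q * n ∈? hs) (column-down {i}) d q q<d)

  abacus-bounded : Bounded d a
  abacus-bounded i with runner a i in eq
  ... | zero  = z≤n
  ... | suc r = let 0<i , i≤m = runner-support a (subst (0 <_) (sym eq) z<s) in
    subst (_≤ d) (trans (sym (runner-abacus d n hs 0<i i≤m)) eq) (count-≤ (λ q → i + q * n ∈? hs) d)

  <runner⇒∈ : ∀ {i q} → q < runner a i → i + q * n ∈ hs
  <runner⇒∈ {i} q<r = let 0<i , i≤m = runner-support a (≤-<-trans z≤n q<r) in
    Equivalence.from (<runner⇔∈ 0<i i≤m (<-≤-trans q<r (abacus-bounded i))) q<r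

  abacus-valid : Valid d a
  abacus-valid = abacus-bounded , alone
    where
    alone : NoNeighbours a
    alone i with runner a i in eq | runner a (suc i) in eq′
    ... | zero  | _     = inj₁ refl
    ... | suc _ | zero  = inj₂ refl
    -- Two occupied neighbouring runners both contain row 0, hence the consecutive beads i and i +
    -- 1.
    ... | suc _ | suc _ = contradiction (<runner⇒∈ {suc i} (subst (0 <_) (sym eq′) z<s))
      (sparse⇒nonConsecutive sparse (<runner⇒∈ {i} (subst (0 <_) (sym eq) z<s)))

  betaSet-abacus : betaSet d n a ≡ hs
  betaSet-abacus = ↓-ext (betaSet-↓ d n a) (sparse⇒↓ sparse) λ z → mk⇔ to from
    where
    to : ∀ {z} → z ∈ betaSet d n a → z ∈ hs
    to z∈ with ∈-beads⁻ n a (∈-betaSet⁻ d n a z∈)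
    ... | i , q , refl , q<r = <runner⇒∈ {i} q<r
    from : ∀ {z} → z ∈ hs → z ∈ betaSet d n a
    from {z} z∈ = ∈-betaSet⁺ d n a (n<1+n m) abacus-bounded
      (subst (_∈ beads n a) (sym z≡) (∈-beads⁺ n a (Equivalence.to
        (<runner⇔∈ (n≢0⇒n>0 z%n≢0) (s≤s⁻¹ (m%n<n z n)) (m<n*o⇒m/o<n (coreSet-< z∈)))
        (subst (_∈ hs) z≡ z∈))))
      where
      z≡ = m≡m%n+[m/n]*n z n
      z%n≢0 : z % n ≢ 0
      z%n≢0 z%n≡0 = coreSet-∤ (z / n) (subst (_∈ hs) (trans z≡ (cong (_+ z / n * n) z%n≡0)) z∈)

-- Distinct cores correspond to abaci

distinctCore⇒coreSet : ∀ d n {ps} → DistinctCore d n ps → CoreSet d n (beta ps)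
distinctCore⇒coreSet d n (distinct , core , core′) =
  distinct⇒sparse distinct , core⇒closed (proj₂ distinct) core , core⇒closed (proj₂ distinct) core′

coreSet⇒distinctCore : ∀ d n {ps} → CoreSet d n (beta ps) → DistinctCore d n ps
coreSet⇒distinctCore d n (sparse , closed , closed′) =
  let distinct = sparse⇒distinct sparse in
  distinct , closed⇒core (proj₂ distinct) closed , closed⇒core (proj₂ distinct) closed′

fromAbacus : ∀ {m} → ℕ → ℕ → Vec ℕ m → List ℕ
fromAbacus d n a = parts (betaSet d n a)

beta-fromAbacus : ∀ {m} d n (a : Vec ℕ m) → beta (fromAbacus d n a) ≡ betaSet d n a
beta-fromAbacus d n a = beta-parts (betaSet-↓ d n a)

cores : ℕ → ℕ → List (List ℕ)
cores d m = map (fromAbacus d (suc m)) (abaci d m)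

-- Reading the abacus back off each core returns `abaci d m`; a repetition among the cores would
-- survive in this image, which has none.
cores-unique : ∀ d m → Unique (cores d m)
cores-unique d m = Unique.map⁻ {f = λ ps → abacus d (suc m) (beta ps) m} (subst Unique (sym eq) (abaci-unique d m))
  where
  eq : map (λ ps → abacus d (suc m) (beta ps) m) (cores d m) ≡ abaci d m
  eq = trans (sym (map-∘ (abaci d m))) (map-id-local (All.tabulate λ {a} a∈ →
    trans (cong (λ hs → abacus d (suc m) hs m) (beta-fromAbacus d (suc m) a))
          (abacus-betaSet d (suc m) a (n<1+n m) (proj₁ (∈-abaci⁻ d m a∈)))))

∈-cores : ∀ d m → 0 < d → ∀ ps → (ps ∈ cores d m) ⇔ DistinctCore d (suc m) ps
∈-cores d m 0<d ps = mk⇔ to from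
  where
  to : ∀ {ps} → ps ∈ cores d m → DistinctCore d (suc m) ps
  to ps∈ with ∈-map⁻ (fromAbacus d (suc m)) ps∈
  ... | a , a∈ , refl = coreSet⇒distinctCore d (suc m) (subst (CoreSet d (suc m)) (sym (beta-fromAbacus d (suc m) a))
                          (betaSet-coreSet d (suc m) a (n<1+n m) (∈-abaci⁻ d m a∈)))
  from : ∀ {ps} → DistinctCore d (suc m) ps → ps ∈ cores d m
  from {ps} dc = subst (_∈ cores d m) (trans (cong parts (betaSet-abacus d m 0<d core)) (parts-beta ps))
      (∈-map⁺ (fromAbacus d (suc m)) (∈-abaci⁺ d m {abacus d (suc m) (beta ps) m} (abacus-valid d m 0<d core)))
    where
    core = distinctCore⇒coreSet d (suc m) dc

-- Total size and length are invariant under permutation, so an arbitrary enumeration may be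
-- replaced by the explicit one.
enumerates⇒↭ : ∀ d m {L} → 0 < d → Enumerates d (suc m) L → L ↭ cores d m
enumerates⇒↭ d m 0<d (L! , L⇔) = unique∧⇔⇒↭ L! (cores-unique d m) λ ps → mk⇔
  (Equivalence.from (∈-cores d m 0<d ps) ∘ Equivalence.to (L⇔ ps))
  (Equivalence.from (L⇔ ps) ∘ Equivalence.to (∈-cores d m 0<d ps))

-- Sums over all abaci

sumOver : ∀ {A : Set} → (A → ℕ) → List A → ℕ
sumOver f xs = sum (map f xs)

sumOver-++ : ∀ {A : Set} (f : A → ℕ) xs ys → sumOver f (xs ++ ys) ≡ sumOver f xs + sumOver f ys
sumOver-++ f xs ys = trans (cong sum (map-++ f xs ys)) (sum-++ (map f xs) (map f ys))

sumOver-*ˡ : ∀ {A : Set} c (f : A → ℕ) xs → sumOver (λ x → c * f x) xs ≡ c * sumOver f xs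
sumOver-*ˡ c f []       = sym (*-zeroʳ c)
sumOver-*ˡ c f (x ∷ xs) = trans (cong (c * f x +_) (sumOver-*ˡ c f xs)) (sym (*-distribˡ-+ c (f x) _))

sumOver-map : ∀ {A B : Set} (f : B → ℕ) (g : A → B) xs → sumOver f (map g xs) ≡ sumOver (f ∘ g) xs
sumOver-map f g xs = cong sum (sym (map-∘ xs))

sumOver-cong : ∀ {A : Set} {f g : A → ℕ} → (∀ x → f x ≡ g x) → ∀ xs → sumOver f xs ≡ sumOver g xs
sumOver-cong eq []       = refl
sumOver-cong eq (x ∷ xs) = cong₂ _+_ (eq x) (sumOver-cong eq xs)

sumOver-affine : ∀ {A : Set} {f f′ h : A → ℕ} α β → (∀ x → f′ x ≡ f x + α * h x + β) → ∀ xs →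
  sumOver f′ xs ≡ sumOver f xs + α * sumOver h xs + β * length xs
sumOver-affine α β eq [] = solve-base α β
  where
  solve-base : ∀ α β → 0 ≡ α * 0 + β * 0
  solve-base = solve-∀
sumOver-affine {f = f} {h = h} α β eq (x ∷ xs) =
  trans (cong₂ _+_ (eq x) (sumOver-affine α β eq xs))
    (regroup (f x) (h x) (sumOver f xs) (sumOver h xs) (length xs) α β)
  where
  regroup : ∀ fx hx F H l α β → fx + α * hx + β + (F + α * H + β * l) ≡ fx + F + α * (hx + H) + β * suc l
  regroup = solve-∀

sumOver-cartesianProductWith : ∀ {A B : Set} {f h : A → ℕ} {f′ : B → ℕ} (g : ℕ → A → B) α β →
  (∀ k x → f′ (g k x) ≡ f x + α k * h x + β k) → ∀ ks xs →
  sumOver f′ (cartesianProductWith g ks xs) ≡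
    length ks * sumOver f xs + sumOver α ks * sumOver h xs + sumOver β ks * length xs
sumOver-cartesianProductWith g α β eq [] xs = refl
sumOver-cartesianProductWith {f = f} {h} {f′} g α β eq (k ∷ ks) xs = begin
  sumOver f′ (map (g k) xs ++ cartesianProductWith g ks xs)
    ≡⟨ sumOver-++ f′ (map (g k) xs) _ ⟩
  sumOver f′ (map (g k) xs) + sumOver f′ (cartesianProductWith g ks xs)
    ≡⟨ cong₂ _+_ (trans (sumOver-map f′ (g k) xs) (sumOver-affine (α k) (β k) (eq k) xs))
                 (sumOver-cartesianProductWith g α β eq ks xs) ⟩
  F + α k * H + β k * l + (length ks * F + sumOver α ks * H + sumOver β ks * l)
    ≡⟨ regroup F H l (α k) (β k) (length ks) (sumOver α ks) (sumOver β ks) ⟩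
  suc (length ks) * F + (α k + sumOver α ks) * H + (β k + sumOver β ks) * l ∎
  where
  open ≡-Reasoning
  F = sumOver f xs
  H = sumOver h xs
  l = length xs
  regroup : ∀ F H l a b n A B → F + a * H + b * l + (n * F + A * H + B * l) ≡ suc n * F + (a + A) * H + (b + B) * l
  regroup = solve-∀

-- Splits off the term at 0 instead of the top one, to pass from bead counts 0, ..., d on a single
-- runner to the power sums over 1, ..., d.
sumOver-downFrom-suc : ∀ φ n → sumOver φ (downFrom (suc n)) ≡ sumOver (φ ∘ suc) (downFrom n) + φ 0
sumOver-downFrom-suc φ zero    = +-identityʳ (φ 0)
sumOver-downFrom-suc φ (suc n) =
  trans (cong (φ (suc n) +_) (sumOver-downFrom-suc φ n)) (sym (+-assoc (φ (suc n)) _ (φ 0)))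

Σ₁ Σ₂ : ℕ → ℕ
Σ₁ n = sumOver suc (downFrom n)
Σ₂ n = sumOver (λ k → suc k * suc k) (downFrom n)

2Σ₁ : ∀ n → 2 * Σ₁ n ≡ n * (n + 1)
2Σ₁ zero    = refl
2Σ₁ (suc n) = trans (*-distribˡ-+ 2 (suc n) (Σ₁ n)) (trans (cong (2 * suc n +_) (2Σ₁ n)) (step n))
  where
  step : ∀ n → 2 * suc n + n * (n + 1) ≡ suc n * (suc n + 1)
  step = solve-∀

6Σ₂ : ∀ n → 6 * Σ₂ n ≡ n * (n + 1) * (2 * n + 1)
6Σ₂ zero    = refl
6Σ₂ (suc n) = trans (*-distribˡ-+ 6 (suc n * suc n) (Σ₂ n)) (trans (cong (6 * (suc n * suc n) +_) (6Σ₂ n)) (step n))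
  where
  step : ∀ n → 6 * (suc n * suc n) + n * (n + 1) * (2 * n + 1) ≡ suc n * (suc n + 1) * (2 * suc n + 1)
  step = solve-∀

length-cartesianProductWith : ∀ {A B C : Set} (g : A → B → C) xs ys →
  length (cartesianProductWith g xs ys) ≡ length xs * length ys
length-cartesianProductWith g []       ys = refl
length-cartesianProductWith g (x ∷ xs) ys = trans (length-++ (map (g x) ys))
  (cong₂ _+_ (length-map (g x) ys) (length-cartesianProductWith g xs ys))

length-abaci : ∀ d m → length (abaci d m) ≡ M d (suc m)
length-abaci d zero          = refl
length-abaci d (suc zero)    = trans (length-map (_∷ []) (downFrom (suc d)))
  (trans (length-downFrom (suc d)) (cong suc (sym (*-identityʳ d))))
length-abaci d (suc (suc m)) = begin
  length (map (0 ∷_) (abaci d (suc m)) ++ cartesianProductWith g (downFrom d) (abaci d m))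
    ≡⟨ length-++ (map (0 ∷_) (abaci d (suc m))) ⟩
  length (map (0 ∷_) (abaci d (suc m))) + length (cartesianProductWith g (downFrom d) (abaci d m))
    ≡⟨ cong₂ _+_ (trans (length-map (0 ∷_) (abaci d (suc m))) (length-abaci d (suc m)))
         (trans (length-cartesianProductWith g (downFrom d) (abaci d m))
                (cong₂ _*_ (length-downFrom d) (length-abaci d m))) ⟩
  M d (suc (suc m)) + d * M d (suc m) ∎
  where
  open ≡-Reasoning
  g : ℕ → Vec ℕ m → Vec ℕ (suc (suc m))
  g k a = suc k ∷ 0 ∷ a

-- One recurrence for all statistics: k + 1 beads on the last runner change each of them affinely in
-- some `h` of the remaining abacus. Only s² has a genuine `h`, namely s, from its cross term.
abaci-recurrence : ∀ d m {f₂ : Vec ℕ (suc (suc m)) → ℕ} {f₁ : Vec ℕ (suc m) → ℕ} {f₀ h : Vec ℕ m → ℕ} α β →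
  (∀ a → f₂ (0 ∷ a) ≡ f₁ a) → (∀ k a → f₂ (suc k ∷ 0 ∷ a) ≡ f₀ a + α k * h a + β k) →
  sumOver f₂ (abaci d (suc (suc m))) ≡ sumOver f₁ (abaci d (suc m)) +
    (d * sumOver f₀ (abaci d m) + sumOver α (downFrom d) * sumOver h (abaci d m) + sumOver β (downFrom d) * M d (suc m))
abaci-recurrence d m {f₂} {f₁} {f₀} {h} α β eq₁ eq₀ = begin
  sumOver f₂ (map (0 ∷_) (abaci d (suc m)) ++ cartesianProductWith g (downFrom d) (abaci d m))
    ≡⟨ sumOver-++ f₂ (map (0 ∷_) (abaci d (suc m))) _ ⟩
  sumOver f₂ (map (0 ∷_) (abaci d (suc m))) + sumOver f₂ (cartesianProductWith g (downFrom d) (abaci d m))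
    ≡⟨ cong₂ _+_ (trans (sumOver-map f₂ (0 ∷_) (abaci d (suc m))) (sumOver-cong eq₁ (abaci d (suc m))))
                 (sumOver-cartesianProductWith g α β eq₀ (downFrom d) (abaci d m)) ⟩
  sumOver f₁ (abaci d (suc m)) + (length (downFrom d) * F + A * H + B * length (abaci d m))
    ≡⟨ cong₂ (λ k l → sumOver f₁ (abaci d (suc m)) + (k * F + A * H + B * l)) (length-downFrom d) (length-abaci d m) ⟩
  sumOver f₁ (abaci d (suc m)) + (d * F + A * H + B * M d (suc m)) ∎
  where
  open ≡-Reasoning
  g : ℕ → Vec ℕ m → Vec ℕ (suc (suc m))
  g k a = suc k ∷ 0 ∷ a
  F = sumOver f₀ (abaci d m)
  H = sumOver h (abaci d m)
  A = sumOver α (downFrom d)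
  B = sumOver β (downFrom d)

-- The size of a core in terms of its bead counts

squares : ∀ {m} → Vec ℕ m → ℕ
squares []      = 0
squares (x ∷ a) = x * x + squares a

moment : ∀ {m} → Vec ℕ m → ℕ
moment         []      = 0
moment {suc m} (x ∷ a) = suc m * x + moment a

length-beads : ∀ {m} n (a : Vec ℕ m) → length (beads n a) ≡ Vec.sum a
length-beads         n []      = refl
length-beads {suc m} n (x ∷ a) = trans (length-++ (map (λ q → suc m + q * n) (downFrom x)))
  (cong₂ _+_ (trans (length-map _ (downFrom x)) (length-downFrom x)) (length-beads n a))

-- An arithmetic progression with sum cx + nx(x - 1)/2, doubled and with the negative term moved
-- left.
sum-column : ∀ c n x → 2 * sumOver (λ q → c + q * n) (downFrom x) + n * x ≡ 2 * (c * x) + n * (x * x)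
sum-column c n zero    = solve-base c n
  where
  solve-base : ∀ c n → n * 0 ≡ 2 * (c * 0) + n * 0
  solve-base = solve-∀
sum-column c n (suc x) = trans (split c n x (sumOver (λ q → c + q * n) (downFrom x)))
  (trans (cong (2 * (c + x * n) + n +_) (sum-column c n x)) (join c n x))
  where
  split : ∀ c n x s → 2 * (c + x * n + s) + n * suc x ≡ 2 * (c + x * n) + n + (2 * s + n * x)
  split = solve-∀
  join : ∀ c n x → 2 * (c + x * n) + n + (2 * (c * x) + n * (x * x)) ≡ 2 * (c * suc x) + n * (suc x * suc x)
  join = solve-∀

sum-beads : ∀ {m} n (a : Vec ℕ m) → 2 * sum (beads n a) + n * Vec.sum a ≡ 2 * moment a + n * squares a
sum-beads         n []      = refl
sum-beads {suc m} n (x ∷ a) = begin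
  2 * sum (column ++ beads n a) + n * (x + Vec.sum a)
    ≡⟨ cong (λ s → 2 * s + n * (x + Vec.sum a)) (sum-++ column (beads n a)) ⟩
  2 * (sum column + sum (beads n a)) + n * (x + Vec.sum a)
    ≡⟨ split (sum column) (sum (beads n a)) n x (Vec.sum a) ⟩
  2 * sum column + n * x + (2 * sum (beads n a) + n * Vec.sum a)
    ≡⟨ cong₂ _+_ (sum-column (suc m) n x) (sum-beads n a) ⟩
  2 * (suc m * x) + n * (x * x) + (2 * moment a + n * squares a)
    ≡⟨ join (suc m * x) n (x * x) (moment a) (squares a) ⟩
  2 * (suc m * x + moment a) + n * (x * x + squares a) ∎
  where
  open ≡-Reasoning
  column = map (λ q → suc m + q * n) (downFrom x)
  split : ∀ c b n x s → 2 * (c + b) + n * (x + s) ≡ 2 * c + n * x + (2 * b + n * s)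
  split = solve-∀
  join : ∀ c n y w q → 2 * c + n * y + (2 * w + n * q) ≡ 2 * (c + w) + n * (y + q)
  join = solve-∀

size-fromAbacus : ∀ {m} d n (a : Vec ℕ m) → m < n → Bounded d a →
  2 * size (fromAbacus d n a) + (Vec.sum a * Vec.sum a + n * Vec.sum a) ≡ 2 * moment a + n * squares a + Vec.sum a
size-fromAbacus d n a m<n a≤d = begin
  2 * size ps + (s * s + n * s)        ≡⟨ +-assoc (2 * size ps) (s * s) (n * s) ⟨
  2 * size ps + s * s + n * s          ≡⟨ cong (_+ n * s) main ⟩
  2 * sum (beads n a) + s + n * s      ≡⟨ swap (2 * sum (beads n a)) s (n * s) ⟩
  2 * sum (beads n a) + n * s + s      ≡⟨ cong (_+ s) (sum-beads n a) ⟩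
  2 * moment a + n * squares a + s     ∎
  where
  open ≡-Reasoning
  ps = fromAbacus d n a
  s = Vec.sum a
  swap : ∀ x y z → x + y + z ≡ x + z + y
  swap = solve-∀
  perm = betaSet↭beads d n a m<n a≤d
  length-ps : length ps ≡ s
  length-ps = trans (length-parts (betaSet d n a)) (trans (↭-length perm) (length-beads n a))
  sum-beta-ps : sum (beta ps) ≡ sum (beads n a)
  sum-beta-ps = trans (cong sum (beta-fromAbacus d n a)) (sum-↭ perm)
  main : 2 * size ps + s * s ≡ 2 * sum (beads n a) + s
  main = subst (λ l → 2 * size ps + l * l ≡ 2 * sum (beads n a) + l) length-ps
    (trans (sum-beta ps) (cong (λ b → 2 * b + length ps) sum-beta-ps))

-- Recurrences for the totals

module Totals (d : ℕ) where

  total totalSq squaresTotal momentTotal : ℕ → ℕ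
  total m        = sumOver Vec.sum (abaci d m)
  totalSq m      = sumOver (λ a → Vec.sum a * Vec.sum a) (abaci d m)
  squaresTotal m = sumOver squares (abaci d m)
  momentTotal m  = sumOver moment (abaci d m)

  sizeTotal : ∀ m → 2 * sum (map size (cores d m)) + (totalSq m + suc m * total m) ≡
                    2 * momentTotal m + suc m * squaresTotal m + total m
  sizeTotal m = trans (cong (λ s → 2 * s + (totalSq m + suc m * total m)) (sumOver-map size (fromAbacus d (suc m)) (abaci d m)))
    (go (abaci d m) λ {a} a∈ → size-fromAbacus d (suc m) a (n<1+n m) (proj₁ (∈-abaci⁻ d m a∈)))
    where
    n = suc m
    split : ∀ n x x′ y y′ z z′ → 2 * (x + x′) + (y + y′ + n * (z + z′)) ≡ 2 * x + (y + n * z) + (2 * x′ + (y′ + n * z′))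
    split = solve-∀
    join : ∀ n x x′ y y′ z z′ → 2 * x + n * y + z + (2 * x′ + n * y′ + z′) ≡ 2 * (x + x′) + n * (y + y′) + (z + z′)
    join = solve-∀
    go : ∀ xs → (∀ {a} → a ∈ xs → 2 * size (fromAbacus d n a) + (Vec.sum a * Vec.sum a + n * Vec.sum a) ≡
                                   2 * moment a + n * squares a + Vec.sum a) →
         2 * sumOver (size ∘ fromAbacus d n) xs + (sumOver (λ a → Vec.sum a * Vec.sum a) xs + n * sumOver Vec.sum xs) ≡
         2 * sumOver moment xs + n * sumOver squares xs + sumOver Vec.sum xs
    go []       _  = solve-base n
      where
      solve-base : ∀ n → n * 0 ≡ n * 0 + 0
      solve-base = solve-∀
    go (a ∷ xs) eq = trans
      (split n (size (fromAbacus d n a)) (sumOver (size ∘ fromAbacus d n) xs) (Vec.sum a * Vec.sum a)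
        (sumOver (λ a → Vec.sum a * Vec.sum a) xs) (Vec.sum a) (sumOver Vec.sum xs))
      (trans (cong₂ _+_ (eq (here refl)) (go xs (eq ∘ there)))
        (join n (moment a) (sumOver moment xs) (squares a) (sumOver squares xs) (Vec.sum a) (sumOver Vec.sum xs)))

  total-one : 2 * total 1 ≡ d * (d + 1)
  total-one = trans (cong (2 *_) (trans (sumOver-map Vec.sum (_∷ []) (downFrom (suc d)))
    (trans (sumOver-downFrom-suc _ d) (trans (+-identityʳ _) (sumOver-cong (λ k → +-identityʳ (suc k)) (downFrom d)))))) (2Σ₁ d)

  momentTotal-one : 2 * momentTotal 1 ≡ d * (d + 1)
  momentTotal-one = trans (cong (2 *_) (trans (sumOver-map moment (_∷ []) (downFrom (suc d)))
    (trans (sumOver-downFrom-suc _ d) (trans (+-identityʳ _) (sumOver-cong simp (downFrom d)))))) (2Σ₁ d)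
    where
    simp : ∀ k → 1 * suc k + 0 ≡ suc k
    simp = solve-∀

  squaresTotal-one : 6 * squaresTotal 1 ≡ d * (d + 1) * (2 * d + 1)
  squaresTotal-one = trans (cong (6 *_) (trans (sumOver-map squares (_∷ []) (downFrom (suc d)))
    (trans (sumOver-downFrom-suc _ d) (trans (+-identityʳ _) (sumOver-cong (λ k → +-identityʳ (suc k * suc k)) (downFrom d)))))) (6Σ₂ d)

  totalSq-one : 6 * totalSq 1 ≡ d * (d + 1) * (2 * d + 1)
  totalSq-one = trans (cong (6 *_) (trans (sumOver-map (λ a → Vec.sum a * Vec.sum a) (_∷ []) (downFrom (suc d)))
    (trans (sumOver-downFrom-suc _ d) (trans (+-identityʳ _) (sumOver-cong (λ k → cong₂ _*_ (+-identityʳ (suc k)) (+-identityʳ (suc k))) (downFrom d)))))) (6Σ₂ d)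

  private
    zeros : sumOver (λ _ → 0) (downFrom d) ≡ 0
    zeros = sumOver-*ˡ 0 suc (downFrom d)

  total-rec : ∀ m → 2 * total (suc (suc m)) ≡ 2 * total (suc m) + (d * (2 * total m) + d * (d + 1) * M d (suc m))
  total-rec m = trans
    (cong (2 *_) (trans (abaci-recurrence d m {f₀ = Vec.sum} {h = λ _ → 0} (λ _ → 0) suc (λ _ → refl) eq)
      (cong (λ z → total (suc m) + (d * total m + z * sumOver (λ _ → 0) (abaci d m) + Σ₁ d * M d (suc m))) zeros)))
    (trans (regroup (total (suc m)) d (total m) (Σ₁ d) (M d (suc m)))
      (cong (λ p → 2 * total (suc m) + (d * (2 * total m) + p * M d (suc m))) (2Σ₁ d)))
    where
    eq : ∀ k (a : Vec ℕ m) → suc k + (0 + Vec.sum a) ≡ Vec.sum a + 0 * 0 + suc k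
    eq k a = reorder (suc k) (Vec.sum a)
      where
      reorder : ∀ k s → k + (0 + s) ≡ s + 0 * 0 + k
      reorder = solve-∀
    regroup : ∀ x d y p u → 2 * (x + (d * y + 0 + p * u)) ≡ 2 * x + (d * (2 * y) + 2 * p * u)
    regroup = solve-∀

  momentTotal-rec : ∀ m → 2 * momentTotal (suc (suc m)) ≡
    2 * momentTotal (suc m) + (d * (2 * momentTotal m) + (m + 2) * (d * (d + 1)) * M d (suc m))
  momentTotal-rec m = trans
    (cong (2 *_) (trans (abaci-recurrence d m {f₀ = moment} {h = λ _ → 0} (λ _ → 0) (λ k → (2 + m) * suc k) eq₁ eq)
      (cong₂ (λ z p → momentTotal (suc m) + (d * momentTotal m + z * sumOver (λ _ → 0) (abaci d m) + p * M d (suc m)))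
        zeros (sumOver-*ˡ (2 + m) suc (downFrom d)))))
    (trans (regroup (momentTotal (suc m)) d (momentTotal m) m (Σ₁ d) (M d (suc m)))
      (cong (λ p → 2 * momentTotal (suc m) + (d * (2 * momentTotal m) + (m + 2) * p * M d (suc m))) (2Σ₁ d)))
    where
    eq₁ : ∀ a → (2 + m) * 0 + moment a ≡ moment a
    eq₁ a = cong (_+ moment a) (*-zeroʳ (2 + m))
    eq : ∀ k (a : Vec ℕ m) → (2 + m) * suc k + (suc m * 0 + moment a) ≡ moment a + 0 * 0 + (2 + m) * suc k
    eq k a = reorder (2 + m) (suc m) (suc k) (moment a)
      where
      reorder : ∀ n m k s → n * k + (m * 0 + s) ≡ s + 0 * 0 + n * k
      reorder = solve-∀
    regroup : ∀ x d y m p u → 2 * (x + (d * y + 0 + (2 + m) * p * u)) ≡ 2 * x + (d * (2 * y) + (m + 2) * (2 * p) * u)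
    regroup = solve-∀

  squaresTotal-rec : ∀ m → 6 * squaresTotal (suc (suc m)) ≡
    6 * squaresTotal (suc m) + (d * (6 * squaresTotal m) + d * (d + 1) * (2 * d + 1) * M d (suc m))
  squaresTotal-rec m = trans
    (cong (6 *_) (trans (abaci-recurrence d m {f₀ = squares} {h = λ _ → 0} (λ _ → 0) (λ k → suc k * suc k) (λ _ → refl) eq)
      (cong (λ z → squaresTotal (suc m) + (d * squaresTotal m + z * sumOver (λ _ → 0) (abaci d m) + Σ₂ d * M d (suc m))) zeros)))
    (trans (regroup (squaresTotal (suc m)) d (squaresTotal m) (Σ₂ d) (M d (suc m)))
      (cong (λ p → 6 * squaresTotal (suc m) + (d * (6 * squaresTotal m) + p * M d (suc m))) (6Σ₂ d)))
    where
    eq : ∀ k (a : Vec ℕ m) → suc k * suc k + (0 + squares a) ≡ squares a + 0 * 0 + suc k * suc k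
    eq k a = reorder (suc k * suc k) (squares a)
      where
      reorder : ∀ k s → k + (0 + s) ≡ s + 0 * 0 + k
      reorder = solve-∀
    regroup : ∀ x d y p u → 6 * (x + (d * y + 0 + p * u)) ≡ 6 * x + (d * (6 * y) + 6 * p * u)
    regroup = solve-∀

  -- Expanding (k + 1 + s)² couples this recurrence to `total m` through 2(k + 1)s; the factor 6
  -- clears the denominators of both power sums.
  totalSq-rec : ∀ m → 6 * totalSq (suc (suc m)) ≡
    6 * totalSq (suc m) + (d * (6 * totalSq m) + 6 * (d * (d + 1)) * total m + d * (d + 1) * (2 * d + 1) * M d (suc m))
  totalSq-rec m = trans
    (cong (6 *_) (trans (abaci-recurrence d m {f₀ = λ a → Vec.sum a * Vec.sum a} {h = Vec.sum} (λ k → 2 * suc k) (λ k → suc k * suc k) (λ _ → refl) eq)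
      (cong (λ p → totalSq (suc m) + (d * totalSq m + p * total m + Σ₂ d * M d (suc m)))
        (trans (sumOver-*ˡ 2 suc (downFrom d)) (2Σ₁ d)))))
    (trans (regroup (totalSq (suc m)) d (totalSq m) (d * (d + 1)) (total m) (Σ₂ d) (M d (suc m)))
      (cong (λ p → 6 * totalSq (suc m) + (d * (6 * totalSq m) + 6 * (d * (d + 1)) * total m + p * M d (suc m))) (6Σ₂ d)))
    where
    eq : ∀ k (a : Vec ℕ m) → (suc k + (0 + Vec.sum a)) * (suc k + (0 + Vec.sum a)) ≡
                              Vec.sum a * Vec.sum a + 2 * suc k * Vec.sum a + suc k * suc k
    eq k a = square (suc k) (Vec.sum a)
      where
      square : ∀ k s → (k + (0 + s)) * (k + (0 + s)) ≡ s * s + 2 * k * s + k * k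
      square = solve-∀
    regroup : ∀ x d y c s p u → 6 * (x + (d * y + c * s + p * u)) ≡ 6 * x + (d * (6 * y) + 6 * c * s + 6 * p * u)
    regroup = solve-∀

-- Rearranges x = b − a, p − q = b − a into x = p − q without subtraction.
transfer : ∀ {x a b} p q → x + a ≡ b → a + p ≡ b + q → x + q ≡ p
transfer {x} {a} {b} p q x+a≡b a+p≡b+q = +-cancelʳ-≡ b (x + q) p (begin
  x + q + b    ≡⟨ rotate x q b ⟩
  b + q + x    ≡⟨ cong (_+ x) a+p≡b+q ⟨
  a + p + x    ≡⟨ rotate′ a p x ⟩
  p + (x + a)  ≡⟨ cong (p +_) x+a≡b ⟩
  p + b        ∎)
  where
  open ≡-Reasoning
  rotate : ∀ x y z → x + y + z ≡ z + y + x
  rotate = solve-∀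
  rotate′ : ∀ x y z → x + y + z ≡ y + (z + x)
  rotate′ = solve-∀

-- Solving the recurrences

module ClosedForms (d : ℕ) where

  open Totals d public

  c D : ℕ
  c = d * (d + 1)
  D = 4 * d + 1

  -- The forcing term is a multiple of `M`, which solves the homogeneous recurrence. This resonance
  -- raises the degree by one, so the coefficients of `M d m` and `M d (suc m)` are linear in m.
  total-closed : ∀ m → D * (2 * total m) + c * (m + 2) * M d m ≡ 2 * c * (m + 1) * M d (suc m)
  total-closed zero = base D c
    where
    base : ∀ D c → D * 0 + c * 2 * 1 ≡ 2 * c * 1 * 1
    base = solve-∀
  total-closed (suc zero) = trans (cong (λ t → D * t + c * 3 * 1) total-one) (base c d)
    where
    base : ∀ c d → (4 * d + 1) * c + c * 3 * 1 ≡ 2 * c * 2 * (1 + d * 1)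
    base = solve-∀
  total-closed (suc (suc m)) = transfer _ _ recurrence (identity c d m (M d (suc m)) (M d m))
    where
    open ≡-Reasoning
    u = M d (suc m)
    v = M d m
    regroup : ∀ D t₁ d t₀ c u a₁ a₀ → D * (t₁ + (d * t₀ + c * u)) + (a₁ + d * a₀) ≡
                                     (D * t₁ + a₁) + d * (D * t₀ + a₀) + D * (c * u)
    regroup = solve-∀
    -- The later values of `M` unfold to u + d * v and u + d * v + d * u, which leaves a polynomial
    -- identity in u and v.
    identity : ∀ c d m u v →
      (c * (1 + m + 2) * u + d * (c * (m + 2) * v)) + 2 * c * (2 + m + 1) * (u + d * v + d * u) ≡
      (2 * c * (1 + m + 1) * (u + d * v) + d * (2 * c * (m + 1) * u) + (4 * d + 1) * (c * u)) + c * (2 + m + 2) * (u + d * v)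
    identity = solve-∀
    recurrence : D * (2 * total (suc (suc m))) + (c * (1 + m + 2) * u + d * (c * (m + 2) * v)) ≡
                 2 * c * (1 + m + 1) * (u + d * v) + d * (2 * c * (m + 1) * u) + D * (c * u)
    recurrence = begin
      D * (2 * total (suc (suc m))) + (c * (1 + m + 2) * u + d * (c * (m + 2) * v))
        ≡⟨ cong (λ t → D * t + (c * (1 + m + 2) * u + d * (c * (m + 2) * v))) (total-rec m) ⟩
      D * (2 * total (suc m) + (d * (2 * total m) + c * u)) + (c * (1 + m + 2) * u + d * (c * (m + 2) * v))
        ≡⟨ regroup D (2 * total (suc m)) d (2 * total m) c u (c * (1 + m + 2) * u) (c * (m + 2) * v) ⟩
      (D * (2 * total (suc m)) + c * (1 + m + 2) * u) + d * (D * (2 * total m) + c * (m + 2) * v) + D * (c * u)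
        ≡⟨ cong₂ (λ x y → x + d * y + D * (c * u)) (total-closed (suc m)) (total-closed m) ⟩
      2 * c * (1 + m + 1) * (u + d * v) + d * (2 * c * (m + 1) * u) + D * (c * u) ∎

  -- This is m + 1 times the closed form of `total`. It is solved separately because (m + 1) *
  -- `total m` does not match the moment recurrence term by term.
  momentTotal-closed : ∀ m → D * (2 * (2 * momentTotal m)) + (m + 1) * (c * (m + 2) * M d m) ≡
                             (m + 1) * (2 * c * (m + 1) * M d (suc m))
  momentTotal-closed zero = base D c
    where
    base : ∀ D c → D * 0 + 1 * (c * 2 * 1) ≡ 1 * (2 * c * 1 * 1)
    base = solve-∀
  momentTotal-closed (suc zero) = trans (cong (λ t → D * (2 * t) + 2 * (c * 3 * 1)) momentTotal-one) (base c d)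
    where
    base : ∀ c d → (4 * d + 1) * (2 * c) + 2 * (c * 3 * 1) ≡ 2 * (2 * c * 2 * (1 + d * 1))
    base = solve-∀
  momentTotal-closed (suc (suc m)) = transfer
    {x = D * (2 * (2 * momentTotal (suc (suc m))))}
    {a = (1 + m + 1) * (c * (1 + m + 2) * M d (suc m)) + d * ((m + 1) * (c * (m + 2) * M d m))}
    _ _ recurrence (identity c d m (M d (suc m)) (M d m))
    where
    open ≡-Reasoning
    u = M d (suc m)
    v = M d m
    a₁ = (1 + m + 1) * (c * (1 + m + 2) * u)
    a₀ = (m + 1) * (c * (m + 2) * v)
    regroup : ∀ D t₁ d t₀ k u a₁ a₀ → D * (2 * (t₁ + (d * t₀ + k * u))) + (a₁ + d * a₀) ≡
                                     (D * (2 * t₁) + a₁) + d * (D * (2 * t₀) + a₀) + D * (2 * (k * u))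
    regroup = solve-∀
    identity : ∀ c d m u v →
      ((1 + m + 1) * (c * (1 + m + 2) * u) + d * ((m + 1) * (c * (m + 2) * v)))
        + (2 + m + 1) * (2 * c * (2 + m + 1) * (u + d * v + d * u)) ≡
      ((1 + m + 1) * (2 * c * (1 + m + 1) * (u + d * v)) + d * ((m + 1) * (2 * c * (m + 1) * u))
        + (4 * d + 1) * (2 * ((m + 2) * c * u))) + (2 + m + 1) * (c * (2 + m + 2) * (u + d * v))
    identity = solve-∀
    recurrence : D * (2 * (2 * momentTotal (suc (suc m)))) + (a₁ + d * a₀) ≡
      (1 + m + 1) * (2 * c * (1 + m + 1) * (u + d * v)) + d * ((m + 1) * (2 * c * (m + 1) * u)) + D * (2 * ((m + 2) * c * u))
    recurrence = begin
      D * (2 * (2 * momentTotal (suc (suc m)))) + (a₁ + d * a₀)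
        ≡⟨ cong (λ t → D * (2 * t) + (a₁ + d * a₀)) (momentTotal-rec m) ⟩
      D * (2 * (2 * momentTotal (suc m) + (d * (2 * momentTotal m) + (m + 2) * c * u))) + (a₁ + d * a₀)
        ≡⟨ regroup D (2 * momentTotal (suc m)) d (2 * momentTotal m) ((m + 2) * c) u a₁ a₀ ⟩
      (D * (2 * (2 * momentTotal (suc m))) + a₁) + d * (D * (2 * (2 * momentTotal m)) + a₀) + D * (2 * ((m + 2) * c * u))
        ≡⟨ cong₂ (λ x y → x + d * y + D * (2 * ((m + 2) * c * u))) (momentTotal-closed (suc m)) (momentTotal-closed m) ⟩
      (1 + m + 1) * (2 * c * (1 + m + 1) * (u + d * v)) + d * ((m + 1) * (2 * c * (m + 1) * u)) + D * (2 * ((m + 2) * c * u)) ∎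

  -- Behind this is the reflection i ↦ m + 1 - i of the runners, which preserves validity. Since the
  -- vectors are built from one end, comparing the two closed forms is the shorter way.
  2*momentTotal : ∀ m → 2 * momentTotal m ≡ (m + 1) * total m
  2*momentTotal m = *-cancelˡ-≡ _ _ (D * 2) {{m*n≢0 D 2 {{>-nonZero (m≤n+m 1 (4 * d))}}}}
    (+-cancelʳ-≡ ((m + 1) * (c * (m + 2) * M d m)) _ _ (begin
      D * 2 * (2 * momentTotal m) + (m + 1) * N       ≡⟨ cong (_+ (m + 1) * N) (*-assoc D 2 _) ⟩
      D * (2 * (2 * momentTotal m)) + (m + 1) * N     ≡⟨ momentTotal-closed m ⟩
      (m + 1) * (2 * c * (m + 1) * M d (suc m))       ≡⟨ cong ((m + 1) *_) (total-closed m) ⟨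
      (m + 1) * (D * (2 * total m) + N)               ≡⟨ regroup D m (total m) N ⟩
      D * 2 * ((m + 1) * total m) + (m + 1) * N       ∎))
    where
    open ≡-Reasoning
    N = c * (m + 2) * M d m
    regroup : ∀ D m t N → (m + 1) * (D * (2 * t) + N) ≡ D * 2 * ((m + 1) * t) + (m + 1) * N
    regroup = solve-∀

  -- Once the occupied runners are fixed, their counts range freely over 1, ..., d, and Σ k² is (2d
  -- + 1)/3 times Σ k. In the recurrences this is the ratio of the forcing terms.
  6*squaresTotal : ∀ m → 6 * squaresTotal m ≡ (2 * d + 1) * (2 * total m)
  6*squaresTotal zero       = sym (*-zeroʳ (2 * d + 1))
  6*squaresTotal (suc zero) = trans squaresTotal-one (trans (*-comm c (2 * d + 1)) (cong ((2 * d + 1) *_) (sym total-one)))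
  6*squaresTotal (suc (suc m)) = begin
    6 * squaresTotal (suc (suc m))
      ≡⟨ squaresTotal-rec m ⟩
    6 * squaresTotal (suc m) + (d * (6 * squaresTotal m) + c * (2 * d + 1) * M d (suc m))
      ≡⟨ cong₂ (λ x y → x + (d * y + c * (2 * d + 1) * M d (suc m))) (6*squaresTotal (suc m)) (6*squaresTotal m) ⟩
    k * (2 * total (suc m)) + (d * (k * (2 * total m)) + c * k * M d (suc m))
      ≡⟨ regroup k (2 * total (suc m)) d (2 * total m) c (M d (suc m)) ⟩
    k * (2 * total (suc m) + (d * (2 * total m) + c * M d (suc m)))
      ≡⟨ cong (k *_) (total-rec m) ⟨
    k * (2 * total (suc (suc m))) ∎
    where
    open ≡-Reasoning
    k = 2 * d + 1
    regroup : ∀ k x d y c u → k * x + (d * (k * y) + c * k * u) ≡ k * (x + (d * y + c * u))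
    regroup = solve-∀

  -- Found by fitting quadratics in m to computed values of totalSq.
  P R : ℕ → ℕ
  P m = 10 + 18 * d + 20 * (d * d) + (13 + 33 * d + 32 * (d * d)) * m + (3 + 15 * d + 12 * (d * d)) * (m * m)
  R m = 10 + 18 * d + 20 * (d * d) + (11 + 39 * d + 34 * (d * d)) * m + (3 + 15 * d + 12 * (d * d)) * (m * m)

  totalSq-closed : ∀ m → 2 * (D * D) * (6 * totalSq m) + c * R m * M d m ≡ c * P m * M d (suc m)
  totalSq-closed zero = base D c d
    where
    base : ∀ D c d → 2 * (D * D) * 0 + c * (10 + 18 * d + 20 * (d * d) + (11 + 39 * d + 34 * (d * d)) * 0 + (3 + 15 * d + 12 * (d * d)) * 0) * 1 ≡
      c * (10 + 18 * d + 20 * (d * d) + (13 + 33 * d + 32 * (d * d)) * 0 + (3 + 15 * d + 12 * (d * d)) * 0) * 1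
    base = solve-∀
  totalSq-closed (suc zero) = trans (cong (λ t → 2 * (D * D) * t + c * R 1 * 1) totalSq-one) (base c d)
    where
    base : ∀ c d → 2 * ((4 * d + 1) * (4 * d + 1)) * (c * (2 * d + 1))
      + c * (10 + 18 * d + 20 * (d * d) + (11 + 39 * d + 34 * (d * d)) * 1 + (3 + 15 * d + 12 * (d * d)) * 1) * 1 ≡
      c * (10 + 18 * d + 20 * (d * d) + (13 + 33 * d + 32 * (d * d)) * 1 + (3 + 15 * d + 12 * (d * d)) * 1) * (1 + d * 1)
    base = solve-∀
  totalSq-closed (suc (suc m)) = transfer _ _ recurrence (identity c d m u v)
    where
    open ≡-Reasoning
    u = M d (suc m)
    v = M d m
    a₁ = c * R (1 + m) * u
    a₀ = c * R m * v
    -- The cross term 2D² · 6c · `total m` equals 6cD · (D · 2 · `total m`); adding 6cD times `aₜ`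
    -- completes it to the left side of `total-closed`.
    aₜ = c * (m + 2) * v
    regroup : ∀ D x₁ d x₀ c t k u a₁ a₀ aₜ →
      2 * (D * D) * (x₁ + (d * x₀ + 6 * c * t + k * u)) + (a₁ + d * a₀ + 6 * c * D * aₜ) ≡
      (2 * (D * D) * x₁ + a₁) + d * (2 * (D * D) * x₀ + a₀) + 6 * c * D * (D * (2 * t) + aₜ) + 2 * (D * D) * (k * u)
    regroup = solve-∀
    -- In the contribution of `total` one factor c is expanded to d * (d + 1); with both kept free,
    -- terms quadratic in c would have to cancel against linear ones.
    identity : ∀ c d m u v →
      (c * (10 + 18 * d + 20 * (d * d) + (11 + 39 * d + 34 * (d * d)) * (1 + m) + (3 + 15 * d + 12 * (d * d)) * ((1 + m) * (1 + m))) * u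
       + d * (c * (10 + 18 * d + 20 * (d * d) + (11 + 39 * d + 34 * (d * d)) * m + (3 + 15 * d + 12 * (d * d)) * (m * m)) * v)
       + 6 * c * (4 * d + 1) * (d * (d + 1) * (m + 2) * v))
      + c * (10 + 18 * d + 20 * (d * d) + (13 + 33 * d + 32 * (d * d)) * (2 + m) + (3 + 15 * d + 12 * (d * d)) * ((2 + m) * (2 + m))) * (u + d * v + d * u)
      ≡
      (c * (10 + 18 * d + 20 * (d * d) + (13 + 33 * d + 32 * (d * d)) * (1 + m) + (3 + 15 * d + 12 * (d * d)) * ((1 + m) * (1 + m))) * (u + d * v)
       + d * (c * (10 + 18 * d + 20 * (d * d) + (13 + 33 * d + 32 * (d * d)) * m + (3 + 15 * d + 12 * (d * d)) * (m * m)) * u)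
       + 6 * c * (4 * d + 1) * (2 * (d * (d + 1)) * (m + 1) * u)
       + 2 * ((4 * d + 1) * (4 * d + 1)) * (c * (2 * d + 1) * u))
      + c * (10 + 18 * d + 20 * (d * d) + (11 + 39 * d + 34 * (d * d)) * (2 + m) + (3 + 15 * d + 12 * (d * d)) * ((2 + m) * (2 + m))) * (u + d * v)
    identity = solve-∀
    recurrence : 2 * (D * D) * (6 * totalSq (suc (suc m))) + (a₁ + d * a₀ + 6 * c * D * aₜ) ≡
      c * P (1 + m) * (u + d * v) + d * (c * P m * u) + 6 * c * D * (2 * c * (m + 1) * u) + 2 * (D * D) * (c * (2 * d + 1) * u)
    recurrence = begin
      2 * (D * D) * (6 * totalSq (suc (suc m))) + (a₁ + d * a₀ + 6 * c * D * aₜ)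
        ≡⟨ cong (λ t → 2 * (D * D) * t + (a₁ + d * a₀ + 6 * c * D * aₜ)) (totalSq-rec m) ⟩
      2 * (D * D) * (6 * totalSq (suc m) + (d * (6 * totalSq m) + 6 * c * total m + c * (2 * d + 1) * u)) + (a₁ + d * a₀ + 6 * c * D * aₜ)
        ≡⟨ regroup D (6 * totalSq (suc m)) d (6 * totalSq m) c (total m) (c * (2 * d + 1)) u a₁ a₀ aₜ ⟩
      (2 * (D * D) * (6 * totalSq (suc m)) + a₁) + d * (2 * (D * D) * (6 * totalSq m) + a₀)
        + 6 * c * D * (D * (2 * total m) + aₜ) + 2 * (D * D) * (c * (2 * d + 1) * u)
        ≡⟨ cong₂ (λ x y → x + d * y + 6 * c * D * (D * (2 * total m) + aₜ) + 2 * (D * D) * (c * (2 * d + 1) * u))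
             (totalSq-closed (suc m)) (totalSq-closed m) ⟩
      c * P (1 + m) * (u + d * v) + d * (c * P m * u)
        + 6 * c * D * (D * (2 * total m) + aₜ) + 2 * (D * D) * (c * (2 * d + 1) * u)
        ≡⟨ cong (λ x → c * P (1 + m) * (u + d * v) + d * (c * P m * u) + 6 * c * D * x + 2 * (D * D) * (c * (2 * d + 1) * u))
             (total-closed m) ⟩
      c * P (1 + m) * (u + d * v) + d * (c * P m * u) + 6 * c * D * (2 * c * (m + 1) * u) + 2 * (D * D) * (c * (2 * d + 1) * u) ∎

  -- By the reflection identity the moment term cancels the term n · s, and the squares become a
  -- multiple of s, so only `total` and `totalSq` remain.
  sizeTotal-reduced : ∀ m → 6 * sum (map size (cores d m)) + 3 * totalSq m ≡ ((m + 1) * (2 * d + 1) + 3) * total m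
  sizeTotal-reduced m = +-cancelʳ-≡ (3 * (suc m * S)) _ _ (begin
    6 * T + 3 * totalSq m + 3 * (suc m * S)        ≡⟨ regroup₁ T (totalSq m) (suc m * S) ⟩
    3 * (2 * T + (totalSq m + suc m * S))          ≡⟨ cong (3 *_) (sizeTotal m) ⟩
    3 * (2 * momentTotal m + suc m * Q + S)        ≡⟨ cong (λ w → 3 * (w + suc m * Q + S)) (2*momentTotal m) ⟩
    3 * ((m + 1) * S + suc m * Q + S)              ≡⟨ regroup₂ m S Q ⟩
    3 * (suc m * S) + 3 * S + suc m * (3 * Q)      ≡⟨ cong (λ q → 3 * (suc m * S) + 3 * S + suc m * q) 3Q ⟩
    3 * (suc m * S) + 3 * S + suc m * ((2 * d + 1) * S) ≡⟨ regroup₃ m (2 * d + 1) S ⟩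
    ((m + 1) * (2 * d + 1) + 3) * S + 3 * (suc m * S) ∎)
    where
    open ≡-Reasoning
    T = sum (map size (cores d m))
    S = total m
    Q = squaresTotal m
    regroup₁ : ∀ t q s → 6 * t + 3 * q + 3 * s ≡ 3 * (2 * t + (q + s))
    regroup₁ = solve-∀
    regroup₂ : ∀ m s q → 3 * ((m + 1) * s + suc m * q + s) ≡ 3 * (suc m * s) + 3 * s + suc m * (3 * q)
    regroup₂ = solve-∀
    regroup₃ : ∀ m k s → 3 * (suc m * s) + 3 * s + suc m * (k * s) ≡ ((m + 1) * k + 3) * s + 3 * (suc m * s)
    regroup₃ = solve-∀
    3Q : 3 * Q ≡ (2 * d + 1) * S
    3Q = *-cancelˡ-≡ _ _ 2 (trans (sym (*-assoc 2 3 Q)) (trans (6*squaresTotal m) (swap (2 * d + 1) S)))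
      where
      swap : ∀ k s → k * (2 * s) ≡ 2 * (k * s)
      swap = solve-∀

  A₁ A₂ A₃ B₁ B₂ : ℕ → ℕ
  A₁ m = c * (5 * d + 1) * (m ^ 2)
  A₂ m = c * (32 * d ^ 2 + 63 * d + 7) * m
  A₃ m = c * (6 * d ^ 2 + 27 * d + 3)
  B₁ m = c * (d ∸ 1) * (m ^ 2)
  B₂ m = c * (14 * d ^ 2 + 21 * d + 1) * m

module _ (e : ℕ) where

  open ClosedForms (suc e)

  -- The theorem multiplied by 24D² and the number of cores. Taking d = suc e lets the truncated d ∸
  -- 1 in `B₁` reduce to e, as the ring solver requires.
  sizeTotal-closed : ∀ m →
    24 * D ^ 2 * sum (map size (cores (suc e) m)) + M (suc e) m * (B₁ m * D + B₂ m + A₃ m * 2) ≡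
    M (suc e) (suc m) * (A₁ m * D + A₂ m + A₃ m * 2)
  sizeTotal-closed m = transfer _ _ relation (identity c e m u v)
    where
    open ≡-Reasoning
    d = suc e
    u = M d (suc m)
    v = M d m
    T = sum (map size (cores d m))
    -- Chosen so that 4D² times the right side of `sizeTotal-reduced` is K · (D · 2 · `total m`),
    -- ready for `total-closed`.
    K = ((m + 1) * (2 * d + 1) + 3) * 2 * D
    aₜ = c * (m + 2) * v
    regroup₁ : ∀ D t x R P Rv → 24 * (D * (D * 1)) * t + (2 * (D * D) * (6 * x) + Rv + P) ≡
                               4 * (D * D) * (6 * t + 3 * x) + Rv + P
    regroup₁ = solve-∀
    regroup₂ : ∀ D k s a Rv → 4 * (D * D) * (k * s) + Rv + k * 2 * D * a ≡ k * 2 * D * (D * (2 * s) + a) + Rv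
    regroup₂ = solve-∀
    identity : ∀ c e m u v →
      (c * (10 + 18 * (1 + e) + 20 * ((1 + e) * (1 + e)) + (13 + 33 * (1 + e) + 32 * ((1 + e) * (1 + e))) * m
             + (3 + 15 * (1 + e) + 12 * ((1 + e) * (1 + e))) * (m * m)) * u
        + ((m + 1) * (2 * (1 + e) + 1) + 3) * 2 * (4 * (1 + e) + 1) * (c * (m + 2) * v))
      + u * (c * (5 * (1 + e) + 1) * (m * (m * 1)) * (4 * (1 + e) + 1)
             + c * (32 * ((1 + e) * ((1 + e) * 1)) + 63 * (1 + e) + 7) * m
             + c * (6 * ((1 + e) * ((1 + e) * 1)) + 27 * (1 + e) + 3) * 2)
      ≡
      (((m + 1) * (2 * (1 + e) + 1) + 3) * 2 * (4 * (1 + e) + 1) * (2 * c * (m + 1) * u)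
        + c * (10 + 18 * (1 + e) + 20 * ((1 + e) * (1 + e)) + (11 + 39 * (1 + e) + 34 * ((1 + e) * (1 + e))) * m
             + (3 + 15 * (1 + e) + 12 * ((1 + e) * (1 + e))) * (m * m)) * v)
      + v * (c * e * (m * (m * 1)) * (4 * (1 + e) + 1)
             + c * (14 * ((1 + e) * ((1 + e) * 1)) + 21 * (1 + e) + 1) * m
             + c * (6 * ((1 + e) * ((1 + e) * 1)) + 27 * (1 + e) + 3) * 2)
    identity = solve-∀
    relation : 24 * D ^ 2 * T + (c * P m * u + K * aₜ) ≡ K * (2 * c * (m + 1) * u) + c * R m * v
    relation = begin
      24 * D ^ 2 * T + (c * P m * u + K * aₜ)
        ≡⟨ cong (λ x → 24 * D ^ 2 * T + (x + K * aₜ)) (totalSq-closed m) ⟨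
      24 * D ^ 2 * T + (2 * (D * D) * (6 * totalSq m) + c * R m * v + K * aₜ)
        ≡⟨ regroup₁ D T (totalSq m) (R m) (K * aₜ) (c * R m * v) ⟩
      4 * (D * D) * (6 * T + 3 * totalSq m) + c * R m * v + K * aₜ
        ≡⟨ cong (λ x → 4 * (D * D) * x + c * R m * v + K * aₜ) (sizeTotal-reduced m) ⟩
      4 * (D * D) * (((m + 1) * (2 * d + 1) + 3) * total m) + c * R m * v + K * aₜ
        ≡⟨ regroup₂ D ((m + 1) * (2 * d + 1) + 3) (total m) aₜ (c * R m * v) ⟩
      K * (D * (2 * total m) + aₜ) + c * R m * v
        ≡⟨ cong (λ x → K * x + c * R m * v) (total-closed m) ⟩
      K * (2 * c * (m + 1) * u) + c * R m * v ∎

-- Clearing denominators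

fromℕ : ℕ → ℚ
fromℕ n = frac n 1

toℚᵘ-frac : ∀ a b → ℚ.toℚᵘ (frac a (suc b)) ℚᵘ.≃ ℚᵘ.mkℚᵘ (ℤ.+ a) b
toℚᵘ-frac a b = ℚ.toℚᵘ-fromℚᵘ (ℚᵘ.mkℚᵘ (ℤ.+ a) b)

fromℕ-+ : ∀ a b → fromℕ (a + b) ≡ fromℕ a ℚ.+ fromℕ b
fromℕ-+ a b = ℚ.toℚᵘ-injective (begin
  ℚ.toℚᵘ (fromℕ (a + b))               ≈⟨ toℚᵘ-frac (a + b) 0 ⟩
  ℚᵘ.mkℚᵘ (ℤ.+ (a + b)) 0                 ≈⟨ ℚᵘ.*≡* (cong (ℤ._* ℤ.+ 1) (trans (ℤ.pos-+ a b) (sym (cong₂ ℤ._+_ (ℤ.*-identityʳ (ℤ.+ a)) (ℤ.*-identityʳ (ℤ.+ b)))))) ⟩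
  ℚᵘ.mkℚᵘ (ℤ.+ a) 0 ℚᵘ.+ ℚᵘ.mkℚᵘ (ℤ.+ b) 0       ≈⟨ ℚᵘ.+-cong (toℚᵘ-frac a 0) (toℚᵘ-frac b 0) ⟨
  ℚ.toℚᵘ (fromℕ a) ℚᵘ.+ ℚ.toℚᵘ (fromℕ b)   ≈⟨ ℚ.toℚᵘ-homo-+ (fromℕ a) (fromℕ b) ⟨
  ℚ.toℚᵘ (fromℕ a ℚ.+ fromℕ b)             ∎)
  where open ℚᵘ.≃-Reasoning

-- The cofactor k allows several fractions to be cleared by one common multiple of their
-- denominators.
frac-* : ∀ a b k .{{_ : NonZero b}} → frac a b ℚ.* fromℕ (b * k) ≡ fromℕ (a * k)
frac-* a (suc b) k = ℚ.toℚᵘ-injective (begin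
  ℚ.toℚᵘ (frac a (suc b) ℚ.* fromℕ (suc b * k))             ≈⟨ ℚ.toℚᵘ-homo-* (frac a (suc b)) (fromℕ (suc b * k)) ⟩
  ℚ.toℚᵘ (frac a (suc b)) ℚᵘ.* ℚ.toℚᵘ (fromℕ (suc b * k))   ≈⟨ ℚᵘ.*-cong (toℚᵘ-frac a b) (toℚᵘ-frac (suc b * k) 0) ⟩
  ℚᵘ.mkℚᵘ (ℤ.+ a) b ℚᵘ.* ℚᵘ.mkℚᵘ (ℤ.+ (suc b * k)) 0              ≈⟨ ℚᵘ.*≡* cross ⟩
  ℚᵘ.mkℚᵘ (ℤ.+ (a * k)) 0                                    ≈⟨ toℚᵘ-frac (a * k) 0 ⟨
  ℚ.toℚᵘ (fromℕ (a * k))                                  ∎)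
  where
  open ℚᵘ.≃-Reasoning
  rearrange : ∀ x y z → x ℤ.* (y ℤ.* z) ℤ.* ℤ.+ 1 ≡ x ℤ.* z ℤ.* y
  rearrange = ℤSolver.solve-∀
  cross : ℤ.+ a ℤ.* ℤ.+ (suc b * k) ℤ.* ℤ.+ 1 ≡ ℤ.+ (a * k) ℤ.* ℤ.+ (suc b * 1)
  cross = trans (cong (λ z → ℤ.+ a ℤ.* z ℤ.* ℤ.+ 1) (ℤ.pos-* (suc b) k))
    (trans (rearrange (ℤ.+ a) (ℤ.+ suc b) (ℤ.+ k))
      (cong₂ ℤ._*_ (sym (ℤ.pos-* a k)) (cong ℤ.+_ (sym (*-identityʳ (suc b))))))

fromℕ-* : ∀ a b → fromℕ (a * b) ≡ fromℕ a ℚ.* fromℕ b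
fromℕ-* a b = sym (trans (cong (λ c → fromℕ a ℚ.* fromℕ c) (sym (*-identityˡ b))) (frac-* a 1 b))

fromℕ-positive : ∀ n .{{_ : NonZero n}} → ℚ.Positive (fromℕ n)
fromℕ-positive n = ℚ.normalize-pos n 1

*-cancelʳ-≡-pos : ∀ {p q} r .{{_ : ℚ.Positive r}} → p ℚ.* r ≡ q ℚ.* r → p ≡ q
*-cancelʳ-≡-pos r eq = ℚ.≤-antisym (ℚ.*-cancelʳ-≤-pos r (ℚ.≤-reflexive eq)) (ℚ.*-cancelʳ-≤-pos r (ℚ.≤-reflexive (sym eq)))

-- Both sides are multiplied by u · 24D². The weights D, 1 and 2 in the hypothesis are the cofactors
-- of 24D, 24D² and 12D² in 24D².
frac≡difference : ∀ T u v D a₁ a₂ a₃ b₁ b₂ .{{_ : NonZero u}} .{{_ : NonZero D}} →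
  24 * D ^ 2 * T + v * (b₁ * D + b₂ + a₃ * 2) ≡ u * (a₁ * D + a₂ + a₃ * 2) →
  frac T u ≡ (frac a₁ (24 * D) ℚ.+ frac a₂ (24 * D ^ 2) ℚ.+ frac a₃ (12 * D ^ 2))
             ℚ.- frac v u ℚ.* (frac b₁ (24 * D) ℚ.+ frac b₂ (24 * D ^ 2) ℚ.+ frac a₃ (12 * D ^ 2))
frac≡difference T u v D a₁ a₂ a₃ b₁ b₂ eq = *-cancelʳ-≡-pos (fromℕ u ℚ.* K)
  {{ℚ.pos*pos⇒pos (fromℕ u) {{fromℕ-positive u}} K {{fromℕ-positive k}}}} (begin
    frac T u ℚ.* (fromℕ u ℚ.* K)
      ≡⟨ ℚ.*-assoc (frac T u) (fromℕ u) K ⟨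
    frac T u ℚ.* fromℕ u ℚ.* K
      ≡⟨ cong (ℚ._* K) (frac-*-self T u) ⟩
    fromℕ T ℚ.* K
      ≡⟨ fromℕ-* T k ⟨
    fromℕ (T * k)
      ≡⟨ add-sub (fromℕ (T * k)) (fromℕ (v * b)) ⟩
    fromℕ (T * k) ℚ.+ fromℕ (v * b) ℚ.- fromℕ (v * b)
      ≡⟨ cong (ℚ._- fromℕ (v * b)) (trans (sym (fromℕ-+ (T * k) (v * b)))
           (cong fromℕ (trans (cong (_+ v * b) (*-comm T k)) eq))) ⟩
    fromℕ (u * a) ℚ.- fromℕ (v * b)
      ≡⟨ cong₂ ℚ._-_ (fromℕ-* u a) (fromℕ-* v b) ⟩
    fromℕ u ℚ.* fromℕ a ℚ.- fromℕ v ℚ.* fromℕ b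
      ≡⟨ cong₂ (λ x y → fromℕ u ℚ.* x ℚ.- fromℕ v ℚ.* y) (clear a₁ a₂) (clear b₁ b₂) ⟨
    fromℕ u ℚ.* (A ℚ.* K) ℚ.- fromℕ v ℚ.* (B ℚ.* K)
      ≡⟨ cong (λ w → fromℕ u ℚ.* (A ℚ.* K) ℚ.- w ℚ.* (B ℚ.* K)) (frac-*-self v u) ⟨
    fromℕ u ℚ.* (A ℚ.* K) ℚ.- frac v u ℚ.* fromℕ u ℚ.* (B ℚ.* K)
      ≡⟨ regroup A B K (fromℕ u) (frac v u) ⟩
    (A ℚ.- frac v u ℚ.* B) ℚ.* (fromℕ u ℚ.* K) ∎)
  where
  open ≡-Reasoning
  open +-*-Solver
  k = 24 * D ^ 2
  K = fromℕ k
  a = a₁ * D + a₂ + a₃ * 2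
  b = b₁ * D + b₂ + a₃ * 2
  A = frac a₁ (24 * D) ℚ.+ frac a₂ k ℚ.+ frac a₃ (12 * D ^ 2)
  B = frac b₁ (24 * D) ℚ.+ frac b₂ k ℚ.+ frac a₃ (12 * D ^ 2)

  instance
    D²≢0 : NonZero (D ^ 2)
    D²≢0 = m^n≢0 D 2
    24D≢0 : NonZero (24 * D)
    24D≢0 = m*n≢0 24 D
    24D²≢0 : NonZero (24 * D ^ 2)
    24D²≢0 = m*n≢0 24 (D ^ 2)
    12D²≢0 : NonZero (12 * D ^ 2)
    12D²≢0 = m*n≢0 12 (D ^ 2)

  frac-*-self : ∀ x y .{{_ : NonZero y}} → frac x y ℚ.* fromℕ y ≡ fromℕ x
  frac-*-self x y = trans (cong (λ z → frac x y ℚ.* fromℕ z) (sym (*-identityʳ y)))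
    (trans (frac-* x y 1) (cong fromℕ (*-identityʳ x)))

  k≡24D*D : k ≡ 24 * D * D
  k≡24D*D = trans (cong (λ x → 24 * (D * x)) (*-identityʳ D)) (sym (*-assoc 24 D D))

  k≡12D²*2 : k ≡ 12 * D ^ 2 * 2
  k≡12D²*2 = trans (*-assoc 2 12 (D ^ 2)) (*-comm 2 (12 * D ^ 2))

  clear : ∀ x y → (frac x (24 * D) ℚ.+ frac y k ℚ.+ frac a₃ (12 * D ^ 2)) ℚ.* K ≡
                  fromℕ (x * D + y + a₃ * 2)
  clear x y = begin
    (frac x (24 * D) ℚ.+ frac y k ℚ.+ frac a₃ (12 * D ^ 2)) ℚ.* K
      ≡⟨ trans (ℚ.*-distribʳ-+ K (frac x (24 * D) ℚ.+ frac y k) _) (cong (ℚ._+ _) (ℚ.*-distribʳ-+ K (frac x (24 * D)) (frac y k))) ⟩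
    frac x (24 * D) ℚ.* K ℚ.+ frac y k ℚ.* K ℚ.+ frac a₃ (12 * D ^ 2) ℚ.* K
      ≡⟨ cong₂ ℚ._+_ (cong₂ ℚ._+_
           (trans (cong (λ z → frac x (24 * D) ℚ.* fromℕ z) k≡24D*D) (frac-* x (24 * D) D))
           (frac-*-self y k))
           (trans (cong (λ z → frac a₃ (12 * D ^ 2) ℚ.* fromℕ z) k≡12D²*2) (frac-* a₃ (12 * D ^ 2) 2)) ⟩
    fromℕ (x * D) ℚ.+ fromℕ y ℚ.+ fromℕ (a₃ * 2)
      ≡⟨ trans (fromℕ-+ (x * D + y) (a₃ * 2)) (cong (ℚ._+ fromℕ (a₃ * 2)) (fromℕ-+ (x * D) y)) ⟨
    fromℕ (x * D + y + a₃ * 2) ∎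

  add-sub : ∀ x y → x ≡ x ℚ.+ y ℚ.- y
  add-sub = solve 2 (λ x y → x := x :+ y :- y) refl

  regroup : ∀ A B K u w → u ℚ.* (A ℚ.* K) ℚ.- w ℚ.* u ℚ.* (B ℚ.* K) ≡ (A ℚ.- w ℚ.* B) ℚ.* (u ℚ.* K)
  regroup = solve 5 (λ A B K u w → u :* (A :* K) :- w :* u :* (B :* K) := (A :- w :* B) :* (u :* K)) refl

-- The expected size

M≢0 : ∀ d k → NonZero (M d k)
M≢0 d zero          = _
M≢0 d (suc zero)    = _
M≢0 d (suc (suc k)) = >-nonZero (≤-trans (>-nonZero⁻¹ (M d (suc k)) {{M≢0 d (suc k)}}) (m≤m+n (M d (suc k)) (d * M d k)))

theorem1p10 : (d n : ℕ) → 0 < d → 0 < n →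
    (L : List (List ℕ)) → Enumerates d n L →
    expectedSize L ≡ formula d n
theorem1p10 d@(suc e) n@(suc m) 0<d _ L enum = begin
  frac (sum (map size L)) (length L)     ≡⟨ cong₂ frac (sum-↭ (map⁺ size L↭cores)) length-L ⟩
  frac (sum (map size (cores d m))) (M d n)
    -- As n is a successor, n ∸ 1 reduces to m and the resulting expression is `formula d n` by
    -- computation.
    ≡⟨ frac≡difference (sum (map size (cores d m))) (M d n) (M d m) D (A₁ m) (A₂ m) (A₃ m) (B₁ m) (B₂ m)
         {{M≢0 d n}} {{>-nonZero (m≤n+m 1 (4 * d))}} (sizeTotal-closed e m) ⟩
  formula d n                            ∎
  where
  open ≡-Reasoning
  open ClosedForms d
  L↭cores = enumerates⇒↭ d m 0<d enum
  length-L : length L ≡ M d n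
  length-L = trans (↭-length L↭cores) (trans (length-map (fromAbacus d n) (abaci d m)) (length-abaci d m))
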